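{- For each $n$ let $\delta$ be a uniformly random transition function of an automaton with state set $[n]$ and alphabet $\{a,b\}$. Let $k:=\lceil 2\sqrt{n\ln n}\rceil$ and let $A:=\delta_{a^k}([n])$ be the set of states that can be reached by performing $k$ $a$-transitions in a row. Then, as $n\to\infty$, $$\mathbb{E}[|A|]\le (1+o(1))\sqrt{2\pi n}.$$
   Context: $[n]=\{1,\dots,n\}$. A random automaton on state set $[n]$ with alphabet $\{a,b\}$ is given by a transition function $\delta:[n]\times\{a,b\}\to[n]$ chosen uniformly among all $n^{2n}$ such functions; equivalently, the values $\delta_c(x):=\delta(x,c)$, for $x\in[n]$, $c\in\{a,b\}$, are independent and uniform on $[n]$. For a word $\omega=\omega_1\omega_2\cdots\omega_m\in\{a,b\}^*$ put $\delta_\omega:=\delta_{\omega_m}\circ\cdots\circ\delta_{\omega_1}$, and for $B\subseteq[n]$ put $\delta_\omega(B):=\{\delta_\omega(x):x\in B\}$. The word $a^k$ is the letter $a$ repeated $k$ times. -}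

module Defs where

open import Data.Bool.Base using (if_then_else_; T)
open import Data.Fin.Base using (Fin; zero; suc; combine; finToFun)
open import Data.Fin.Properties using (any?)
import Data.Fin.Properties as Fin
open import Data.Fin.Subset using (Subset; _∈_)
open import Data.Fin.Subset.Properties using (_∈?_)
open import Data.Integer.Base as ℤ using (ℤ; +_)
import Data.Integer.Properties as ℤ
open import Data.List.Base using (List; foldl)
open import Data.Nat.Base as ℕ using (ℕ; zero; suc; NonZero; _≤ᵇ_)
import Data.Nat.Properties as ℕ
open import Data.Nat.Tactic.RingSolver using (solve-∀)
open import Data.Product.Base using (Σ-syntax; ∃-syntax; _×_; _,_; proj₁; proj₂)
open import Data.Rational.Base as ℚ
  using (ℚ; mkℚ; 0ℚ; 1ℚ; ½; _/_; _+_; _-_; -_; _*_; ↥_; ↧ₙ_)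
import Data.Rational.Properties as ℚ
open import Data.Rational.Solver using (module +-*-Solver)
open import Data.Rational.Unnormalised.Base as ℚᵘ using (mkℚᵘ)
import Data.Rational.Unnormalised.Properties as ℚᵘ
open import Data.Sum.Base using (inj₁; inj₂)
open import Data.Vec.Base using (tabulate)
open import Relation.Binary.PropositionalEquality
open import Relation.Nullary using (does)
open import Relation.Nullary.Decidable using (_×-dec_)

open import Algebra.Properties.CommutativeMonoid.Sum ℕ.+-0-commutativeMonoid
  using (sum)

------------------------------------------------------------------------
-- Auxiliary facts about ℕ and ℚ

private

  /-mono-≤ : ∀ a b c d .{{_ : NonZero b}} .{{_ : NonZero d}} →
             a ℕ.* d ℕ.≤ c ℕ.* b → + a / b ℚ.≤ + c / d
  /-mono-≤ a (suc b) c (suc d) le = ℚ.toℚᵘ-cancel-≤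
    (ℚᵘ.≤-respˡ-≃ (ℚᵘ.≃-sym (ℚ.toℚᵘ-fromℚᵘ (mkℚᵘ (+ a) b)))
    (ℚᵘ.≤-respʳ-≃ (ℚᵘ.≃-sym (ℚ.toℚᵘ-fromℚᵘ (mkℚᵘ (+ c) d)))
    (ℚᵘ.*≤* (subst₂ ℤ._≤_ (ℤ.pos-* a (suc d)) (ℤ.pos-* c (suc b))
              (ℤ.+≤+ le)))))

  /-≡ : ∀ a b c d .{{_ : NonZero b}} .{{_ : NonZero d}} →
        a ℕ.* d ≡ c ℕ.* b → + a / b ≡ + c / d
  /-≡ a b c d eq = ℚ.≤-antisym (/-mono-≤ a b c d (ℕ.≤-reflexive eq))
                               (/-mono-≤ c d a b (ℕ.≤-reflexive (sym eq)))

  /-* : ∀ a b c d → (+ a / suc b) * (+ c / suc d)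
                    ≡ + (a ℕ.* c) / (suc b ℕ.* suc d)
  /-* a b c d = ℚ.toℚᵘ-injective
    (ℚᵘ.≃-trans (ℚ.toℚᵘ-homo-* (+ a / suc b) (+ c / suc d))
    (ℚᵘ.≃-trans (ℚᵘ.*-cong (ℚ.toℚᵘ-fromℚᵘ (mkℚᵘ (+ a) b))
                           (ℚ.toℚᵘ-fromℚᵘ (mkℚᵘ (+ c) d)))
    (ℚᵘ.≃-trans (ℚᵘ.≃-reflexive (cong (λ z → mkℚᵘ z (d ℕ.+ b ℕ.* suc d))
                                  (sym (ℤ.pos-* a c))))
                (ℚᵘ.≃-sym (ℚ.toℚᵘ-fromℚᵘ
                  (mkℚᵘ (+ (a ℕ.* c)) (d ℕ.+ b ℕ.* suc d)))))))

  /-+ : ∀ a b c d → (+ a / suc b) + (+ c / suc d)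
                    ≡ + (a ℕ.* suc d ℕ.+ c ℕ.* suc b) / (suc b ℕ.* suc d)
  /-+ a b c d = ℚ.toℚᵘ-injective
    (ℚᵘ.≃-trans (ℚ.toℚᵘ-homo-+ (+ a / suc b) (+ c / suc d))
    (ℚᵘ.≃-trans (ℚᵘ.+-cong (ℚ.toℚᵘ-fromℚᵘ (mkℚᵘ (+ a) b))
                           (ℚ.toℚᵘ-fromℚᵘ (mkℚᵘ (+ c) d)))
    (ℚᵘ.≃-trans (ℚᵘ.≃-reflexive (cong (λ z → mkℚᵘ z (d ℕ.+ b ℕ.* suc d))
                  (trans (cong₂ ℤ._+_ (sym (ℤ.pos-* a (suc d)))
                                      (sym (ℤ.pos-* c (suc b))))
                         (sym (ℤ.pos-+ (a ℕ.* suc d) (c ℕ.* suc b))))))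
                (ℚᵘ.≃-sym (ℚ.toℚᵘ-fromℚᵘ
                  (mkℚᵘ (+ (a ℕ.* suc d ℕ.+ c ℕ.* suc b))
                        (d ℕ.+ b ℕ.* suc d)))))))

  archimedean : ∀ ε → 0ℚ ℚ.< ε → ∃[ N ] + 1 / suc N ℚ.≤ ε
  archimedean ε@(mkℚ (+ suc p) d _) _ = d , subst (+ 1 / suc d ℚ.≤_)
    (ℚ.↥p/↧p≡p ε)
    (/-mono-≤ 1 (suc d) (suc p) (suc d) (ℕ.*-monoˡ-≤ (suc d) {1} {suc p} (ℕ.s≤s ℕ.z≤n)))
  archimedean (mkℚ (+ zero) d _) 0<ε with () ← ℚ.positive 0<ε
  archimedean (mkℚ ℤ.-[1+ _ ] d _) 0<ε with () ← ℚ.positive 0<ε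

  half+half : ∀ ε → ½ * ε + ½ * ε ≡ ε
  half+half ε = trans (sym (ℚ.*-distribʳ-+ ε ½ ½)) (ℚ.*-identityˡ ε)

------------------------------------------------------------------------
-- Real numbers as Cauchy sequences of rationals

-- Since m and n are arbitrary beyond N, exchanging them gives the usual
-- condition ∣ x m - x n ∣ ≤ ε.
IsCauchy : (ℕ → ℚ) → Set
IsCauchy x = ∀ ε → 0ℚ ℚ.< ε →
  ∃[ N ] (∀ m n → N ℕ.≤ m → N ℕ.≤ n → x m ℚ.≤ x n + ε)

record ℝ : Set where
  constructor mkℝ
  field
    approx : ℕ → ℚ
    cauchy : IsCauchy approx

open ℝ public

infix 4 _≤_ _<_

_≤_ : ℝ → ℝ → Set
x ≤ y = ∀ ε → 0ℚ ℚ.< ε →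
  ∃[ N ] (∀ n → N ℕ.≤ n → approx x n ℚ.≤ approx y n + ε)

_<_ : ℝ → ℝ → Set
x < y = Σ[ ε ∈ ℚ ] 0ℚ ℚ.< ε ×
  ∃[ N ] (∀ n → N ℕ.≤ n → approx x n + ε ℚ.≤ approx y n)

fromℚ : ℚ → ℝ
fromℚ q = mkℝ (λ _ → q) λ ε 0<ε → 0 , λ _ _ _ _ →
  ℚ.≤-trans (ℚ.≤-reflexive (sym (ℚ.+-identityʳ q))) (ℚ.+-monoʳ-≤ q (ℚ.<⇒≤ 0<ε))

fromℕ : ℕ → ℚ
fromℕ n = + n / 1

private

  scale-modulus : ∀ c ε → 0ℚ ℚ.< ε → Σ[ δ ∈ ℚ ] 0ℚ ℚ.< δ × ℚ.∣ c ∣ * δ ℚ.≤ ε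
  scale-modulus c ε 0<ε = go (ℚ.∣ c ∣ + 1ℚ) 0<B ∣c∣≤B
    where
    0<B : 0ℚ ℚ.< ℚ.∣ c ∣ + 1ℚ
    0<B = ℚ.+-mono-≤-< (ℚ.0≤∣p∣ c) (ℚ.positive⁻¹ 1ℚ)

    ∣c∣≤B : ℚ.∣ c ∣ ℚ.≤ ℚ.∣ c ∣ + 1ℚ
    ∣c∣≤B = subst (ℚ._≤ ℚ.∣ c ∣ + 1ℚ) (ℚ.+-identityʳ ℚ.∣ c ∣)
      (ℚ.+-monoʳ-≤ ℚ.∣ c ∣ (ℚ.<⇒≤ (ℚ.positive⁻¹ 1ℚ)))

    go : ∀ B → 0ℚ ℚ.< B → ℚ.∣ c ∣ ℚ.≤ B → Σ[ δ ∈ ℚ ] 0ℚ ℚ.< δ × ℚ.∣ c ∣ * δ ℚ.≤ ε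
    go B 0<B ∣c∣≤B = B⁻¹ * ε , ℚ.positive⁻¹ (B⁻¹ * ε) {{δ>0}} ,
      subst (ℚ.∣ c ∣ * (B⁻¹ * ε) ℚ.≤_) Bδ≡ε
        (ℚ.*-monoʳ-≤-nonNeg (B⁻¹ * ε) {{ℚ.pos⇒nonNeg (B⁻¹ * ε) {{δ>0}}}} ∣c∣≤B)
      where
      B>0 = ℚ.positive 0<B
      B≢0 = ℚ.pos⇒nonZero B {{B>0}}
      B⁻¹ = (ℚ.1/ B) {{B≢0}}
      δ>0 = ℚ.pos*pos⇒pos B⁻¹ {{ℚ.1/pos⇒pos B {{B>0}}}} ε {{ℚ.positive 0<ε}}
      Bδ≡ε : B * (B⁻¹ * ε) ≡ ε
      Bδ≡ε = trans (sym (ℚ.*-assoc B B⁻¹ ε))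
        (trans (cong (_* ε) (ℚ.*-inverseʳ B {{B≢0}})) (ℚ.*-identityˡ ε))

  scale-close : ∀ c p q δ ε → ℚ.∣ c ∣ * δ ℚ.≤ ε →
                p ℚ.≤ q + δ → q ℚ.≤ p + δ → c * p ℚ.≤ c * q + ε
  scale-close c p q δ ε cδ≤ε p≤ q≤ with ℚ.≤-total 0ℚ c
  ... | inj₁ 0≤c = begin
    c * p           ≤⟨ ℚ.*-monoˡ-≤-nonNeg c {{ℚ.nonNegative 0≤c}} p≤ ⟩
    c * (q + δ)     ≡⟨ ℚ.*-distribˡ-+ c q δ ⟩
    c * q + c * δ   ≤⟨ ℚ.+-monoʳ-≤ (c * q)
                         (subst (λ d → d * δ ℚ.≤ ε) (ℚ.0≤p⇒∣p∣≡p 0≤c) cδ≤ε) ⟩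
    c * q + ε       ∎
    where open ℚ.≤-Reasoning
  ... | inj₂ c≤0 = begin
    c * p                     ≡⟨ eq c p δ ⟩
    c * (p + δ) + (- c) * δ   ≤⟨ ℚ.+-mono-≤
                                   (ℚ.*-monoˡ-≤-nonPos c {{ℚ.nonPositive c≤0}} q≤)
                                   (subst (λ d → d * δ ℚ.≤ ε) ∣c∣≡-c cδ≤ε) ⟩
    c * q + ε                 ∎
    where
    open ℚ.≤-Reasoning
    ∣c∣≡-c : ℚ.∣ c ∣ ≡ - c
    ∣c∣≡-c = trans (sym (ℚ.∣-p∣≡∣p∣ c)) (ℚ.0≤p⇒∣p∣≡p (ℚ.neg-antimono-≤ c≤0))
    eq : ∀ c x δ → c * x ≡ c * (x + δ) + (- c) * δ
    eq = solve 3 (λ c x δ → c :* x := c :* (x :+ δ) :+ (:- c) :* δ) refl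
      where open +-*-Solver

infixl 7 _·_

_·_ : ℚ → ℝ → ℝ
c · x = mkℝ (λ n → c * approx x n) λ ε 0<ε →
  let δ , 0<δ , cδ≤ε = scale-modulus c ε 0<ε
      N , close      = cauchy x δ 0<δ
  in  N , λ m n N≤m N≤n → scale-close c (approx x m) (approx x n) δ ε cδ≤ε
        (close m n N≤m N≤n) (close n m N≤n N≤m)

------------------------------------------------------------------------
-- Square roots

⌊√_⌋ : ℕ → ℕ
⌊√ zero  ⌋ = 0
⌊√ suc n ⌋ = let r = ⌊√ n ⌋ in
  if suc r ℕ.* suc r ≤ᵇ suc n then suc r else r

⌊√⌋-spec : ∀ n → ⌊√ n ⌋ ℕ.* ⌊√ n ⌋ ℕ.≤ n × n ℕ.< suc ⌊√ n ⌋ ℕ.* suc ⌊√ n ⌋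
⌊√⌋-spec zero = ℕ.z≤n , ℕ.s≤s ℕ.z≤n
⌊√⌋-spec (suc n) with ⌊√ n ⌋ | ⌊√⌋-spec n
... | r | lo , hi with suc r ℕ.* suc r ≤ᵇ suc n in eq
...   | Data.Bool.Base.true =
        ℕ.≤ᵇ⇒≤ _ _ (subst T (sym eq) _) ,
        ℕ.≤-<-trans hi (ℕ.*-mono-< (ℕ.n<1+n (suc r)) (ℕ.n<1+n (suc r)))
...   | Data.Bool.Base.false =
        ℕ.m≤n⇒m≤1+n lo , ℕ.≰⇒> λ le → subst T eq (ℕ.≤⇒≤ᵇ le)

-- For q = ± p / d we have √ ∣ q ∣ = √ (p d M²) / (d M); rounding the
-- numerator down to an integer costs at most 1 / M, where M = m + 1.
√-approx : ℕ → ℚ → ℚ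
√-approx m q =
  + ⌊√ ℤ.∣ ↥ q ∣ ℕ.* ↧ₙ q ℕ.* (suc m ℕ.* suc m) ⌋ / (↧ₙ q ℕ.* suc m)

private

  √-approx-nonNeg : ∀ m q → 0ℚ ℚ.≤ √-approx m q
  √-approx-nonNeg m q@(mkℚ _ d _) =
    /-mono-≤ 0 1 ⌊√ ℤ.∣ ↥ q ∣ ℕ.* ↧ₙ q ℕ.* (suc m ℕ.* suc m) ⌋
      (suc d ℕ.* suc m) ℕ.z≤n

  √-approx-lower : ∀ m q → √-approx m q * √-approx m q ℚ.≤ ℚ.∣ q ∣
  √-approx-lower m q@(mkℚ i d _) = subst₂ ℚ._≤_
    (sym (/-* s (m ℕ.+ d ℕ.* suc m) s (m ℕ.+ d ℕ.* suc m)))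
    (ℚ.↥p/↧p≡p ℚ.∣ q ∣)
    (/-mono-≤ (s ℕ.* s) (suc d ℕ.* suc m ℕ.* (suc d ℕ.* suc m)) p (suc d)
      (ℕ.≤-trans (ℕ.*-monoˡ-≤ (suc d) (proj₁ (⌊√⌋-spec k)))
                 (ℕ.≤-reflexive (eq p (suc d) (suc m)))))
    where
    p = ℤ.∣ i ∣
    k = p ℕ.* suc d ℕ.* (suc m ℕ.* suc m)
    s = ⌊√ k ⌋
    eq : ∀ p d m → p ℕ.* d ℕ.* (m ℕ.* m) ℕ.* d ≡ p ℕ.* (d ℕ.* m ℕ.* (d ℕ.* m))
    eq = solve-∀

  √-approx-upper : ∀ m q →
    let r = √-approx m q + + 1 / suc m in ℚ.∣ q ∣ ℚ.≤ r * r
  √-approx-upper m q@(mkℚ i d _) = begin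
    ℚ.∣ q ∣                    ≡⟨ ℚ.↥p/↧p≡p ℚ.∣ q ∣ ⟨
    + p / suc d                ≤⟨ /-mono-≤ p (suc d) (suc s ℕ.* suc s) (D ℕ.* D)
                                    (ℕ.≤-trans (ℕ.≤-reflexive (eq p (suc d) (suc m)))
                                      (ℕ.*-monoˡ-≤ (suc d)
                                        (ℕ.<⇒≤ (proj₂ (⌊√⌋-spec k))))) ⟩
    + (suc s ℕ.* suc s) / (D ℕ.* D)
                               ≡⟨ /-* (suc s) (m ℕ.+ d ℕ.* suc m)
                                      (suc s) (m ℕ.+ d ℕ.* suc m) ⟨
    r′ * r′                    ≤⟨ ℚ.*-monoʳ-≤-nonNeg r′ {{ℚ.nonNegative 0≤r′}} r′≤r ⟩
    r * r′                     ≤⟨ ℚ.*-monoˡ-≤-nonNeg r {{ℚ.nonNegative (ℚ.≤-trans 0≤r′ r′≤r)}}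
                                    r′≤r ⟩
    r * r                      ∎
    where
    open ℚ.≤-Reasoning
    p = ℤ.∣ i ∣
    k = p ℕ.* suc d ℕ.* (suc m ℕ.* suc m)
    s = ⌊√ k ⌋
    D = suc d ℕ.* suc m
    r = √-approx m q + + 1 / suc m
    r′ = + suc s / D
    0≤r′ : 0ℚ ℚ.≤ r′
    0≤r′ = /-mono-≤ 0 1 (suc s) D ℕ.z≤n
    eq : ∀ p d m → p ℕ.* (d ℕ.* m ℕ.* (d ℕ.* m)) ≡ p ℕ.* d ℕ.* (m ℕ.* m) ℕ.* d
    eq = solve-∀
    le : suc s ℕ.* (D ℕ.* suc m) ℕ.≤ (s ℕ.* suc m ℕ.+ 1 ℕ.* D) ℕ.* D
    le = ℕ.≤-trans (ℕ.≤-reflexive (e₁ s D (suc m)))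
           (ℕ.*-monoˡ-≤ D (ℕ.+-monoʳ-≤ (s ℕ.* suc m)
             (ℕ.≤-trans (ℕ.m≤n*m (suc m) (suc d))
               (ℕ.≤-reflexive (sym (ℕ.*-identityˡ D))))))
      where
      e₁ : ∀ s D m → suc s ℕ.* (D ℕ.* m) ≡ (s ℕ.* m ℕ.+ m) ℕ.* D
      e₁ = solve-∀
    r′≤r : r′ ℚ.≤ r
    r′≤r = subst (r′ ℚ.≤_) (sym (/-+ s (m ℕ.+ d ℕ.* suc m) 1 m))
      (/-mono-≤ (suc s) D (s ℕ.* suc m ℕ.+ 1 ℕ.* D) (D ℕ.* suc m) le)

  p≤∣p∣ : ∀ p → p ℚ.≤ ℚ.∣ p ∣
  p≤∣p∣ p with ℚ.≤-total 0ℚ p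
  ... | inj₁ 0≤p = ℚ.≤-reflexive (sym (ℚ.0≤p⇒∣p∣≡p 0≤p))
  ... | inj₂ p≤0 = ℚ.≤-trans p≤0 (ℚ.0≤∣p∣ p)

  -p≤∣p∣ : ∀ p → - p ℚ.≤ ℚ.∣ p ∣
  -p≤∣p∣ p = subst (- p ℚ.≤_) (ℚ.∣-p∣≡∣p∣ p) (p≤∣p∣ (- p))

  ∣∣-close : ∀ p q δ → p ℚ.≤ q + δ → q ℚ.≤ p + δ → ℚ.∣ p ∣ ℚ.≤ ℚ.∣ q ∣ + δ
  ∣∣-close p q δ p≤ q≤ with ℚ.∣p∣≡p∨∣p∣≡-p p
  ... | inj₁ eq = subst (ℚ._≤ ℚ.∣ q ∣ + δ) (sym eq)
          (ℚ.≤-trans p≤ (ℚ.+-monoˡ-≤ δ (p≤∣p∣ q)))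
  ... | inj₂ eq = subst (ℚ._≤ ℚ.∣ q ∣ + δ) (sym eq)
          (ℚ.≤-trans
            (subst₂ ℚ._≤_ (e₁ p q) (e₂ p q δ) (ℚ.+-monoˡ-≤ (- p - q) q≤))
            (ℚ.+-monoˡ-≤ δ (-p≤∣p∣ q)))
    where
    open +-*-Solver
    e₁ : ∀ p q → q + (- p - q) ≡ - p
    e₁ = solve 2 (λ p q → q :+ (:- p :- q) := :- p) refl
    e₂ : ∀ p q δ → p + δ + (- p - q) ≡ - q + δ
    e₂ = solve 3 (λ p q δ → p :+ δ :+ (:- p :- q) := :- q :+ δ) refl

  sqr-mono-≤ : ∀ p q → 0ℚ ℚ.≤ p → p ℚ.≤ q → p * p ℚ.≤ q * q
  sqr-mono-≤ p q 0≤p p≤q = ℚ.≤-trans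
    (ℚ.*-monoˡ-≤-nonNeg p {{ℚ.nonNegative 0≤p}} p≤q)
    (ℚ.*-monoʳ-≤-nonNeg q {{ℚ.nonNegative (ℚ.≤-trans 0≤p p≤q)}} p≤q)

  sqr-mono-< : ∀ p q → 0ℚ ℚ.≤ p → p ℚ.< q → p * p ℚ.< q * q
  sqr-mono-< p q 0≤p p<q = ℚ.≤-<-trans
    (ℚ.*-monoˡ-≤-nonNeg p {{ℚ.nonNegative 0≤p}} (ℚ.<⇒≤ p<q))
    (ℚ.*-monoˡ-<-pos q {{ℚ.positive (ℚ.≤-<-trans 0≤p p<q)}} p<q)

  *-nonNeg : ∀ p q → 0ℚ ℚ.≤ p → 0ℚ ℚ.≤ q → 0ℚ ℚ.≤ p * q
  *-nonNeg p q 0≤p 0≤q = ℚ.nonNegative⁻¹ (p * q)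
    {{ℚ.nonNeg*nonNeg⇒nonNeg p {{ℚ.nonNegative 0≤p}} q {{ℚ.nonNegative 0≤q}}}}

  √-close : ∀ u v t η p q → 0ℚ ℚ.≤ v → 0ℚ ℚ.≤ t → 0ℚ ℚ.≤ η → t ℚ.≤ η →
            u * u ℚ.≤ p → q ℚ.≤ (v + t) * (v + t) → p ℚ.≤ q + η * η →
            u ℚ.≤ v + (η + η)
  √-close u v t η p q 0≤v 0≤t 0≤η t≤η u²≤p q≤ p≤ = ℚ.≮⇒≥ λ w<u →
    ℚ.<-irrefl refl (begin-strict
      w * w                              <⟨ sqr-mono-< w u 0≤w w<u ⟩
      u * u                              ≤⟨ u²≤p ⟩
      p                                  ≤⟨ p≤ ⟩
      q + η * η                          ≤⟨ ℚ.+-monoˡ-≤ (η * η) q≤ ⟩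
      (v + t) * (v + t) + η * η          ≤⟨ ℚ.+-monoˡ-≤ (η * η)
                                              (sqr-mono-≤ (v + t) (v + η)
                                                (ℚ.+-mono-≤ 0≤v 0≤t)
                                                (ℚ.+-monoʳ-≤ v t≤η)) ⟩
      (v + η) * (v + η) + η * η          ≡⟨ ℚ.+-identityʳ _ ⟨
      (v + η) * (v + η) + η * η + 0ℚ     ≤⟨ ℚ.+-monoʳ-≤ ((v + η) * (v + η) + η * η) 0≤rest ⟩
      (v + η) * (v + η) + η * η + rest   ≡⟨ expand v η ⟩
      w * w                              ∎)
    where
    open ℚ.≤-Reasoning
    w = v + (η + η)
    rest = (η * v + η * v) + (η * η + η * η)

    0≤w : 0ℚ ℚ.≤ w
    0≤w = ℚ.+-mono-≤ 0≤v (ℚ.+-mono-≤ 0≤η 0≤η)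

    0≤rest : 0ℚ ℚ.≤ rest
    0≤rest = ℚ.+-mono-≤
      (ℚ.+-mono-≤ (*-nonNeg η v 0≤η 0≤v) (*-nonNeg η v 0≤η 0≤v))
      (ℚ.+-mono-≤ (*-nonNeg η η 0≤η 0≤η) (*-nonNeg η η 0≤η 0≤η))

    expand : ∀ v η → (v + η) * (v + η) + η * η + ((η * v + η * v) + (η * η + η * η))
                     ≡ (v + (η + η)) * (v + (η + η))
    expand = solve 2 (λ v η →
      (v :+ η) :* (v :+ η) :+ η :* η :+ ((η :* v :+ η :* v) :+ (η :* η :+ η :* η))
      := (v :+ (η :+ η)) :* (v :+ (η :+ η))) refl
      where open +-*-Solver

  √-approx-isCauchy : ∀ x → IsCauchy x → IsCauchy (λ n → √-approx n (x n))
  √-approx-isCauchy x x-cauchy ε 0<ε = go (½ * ε) (half+half ε)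
    (ℚ.positive⁻¹ (½ * ε) {{ℚ.pos*pos⇒pos ½ ε {{ℚ.positive 0<ε}}}})
    where
    go : ∀ η → η + η ≡ ε → 0ℚ ℚ.< η → ∃[ N ] (∀ m n → N ℕ.≤ m → N ℕ.≤ n →
           √-approx m (x m) ℚ.≤ √-approx n (x n) + ε)
    go η refl 0<η = N₁ ℕ.⊔ N₂ , λ m n N≤m N≤n →
      √-close (√-approx m (x m)) (√-approx n (x n)) (+ 1 / suc n) η
        ℚ.∣ x m ∣ ℚ.∣ x n ∣
        (√-approx-nonNeg n (x n))
        (/-mono-≤ 0 1 1 (suc n) ℕ.z≤n)
        (ℚ.<⇒≤ 0<η)
        (ℚ.≤-trans
          (/-mono-≤ 1 (suc n) 1 (suc N₂)
            (ℕ.*-monoʳ-≤ 1 (ℕ.s≤s (ℕ.≤-trans (ℕ.m≤n⊔m N₁ N₂) N≤n))))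
          (proj₂ arch))
        (√-approx-lower m (x m))
        (√-approx-upper n (x n))
        (∣∣-close (x m) (x n) (η * η)
          (proj₂ near m n (N₁≤ N≤m) (N₁≤ N≤n))
          (proj₂ near n m (N₁≤ N≤n) (N₁≤ N≤m)))
      where
      near = x-cauchy (η * η)
        (ℚ.positive⁻¹ (η * η)
          {{ℚ.pos*pos⇒pos η {{ℚ.positive 0<η}} η {{ℚ.positive 0<η}}}})
      arch = archimedean η 0<η
      N₁ = proj₁ near
      N₂ = proj₁ arch
      N₁≤ : ∀ {k} → N₁ ℕ.⊔ N₂ ℕ.≤ k → N₁ ℕ.≤ k
      N₁≤ = ℕ.≤-trans (ℕ.m≤m⊔n N₁ N₂)

-- √ ∣ x ∣ when x is negative.
√_ : ℝ → ℝ
√ x = mkℝ (λ n → √-approx n (approx x n)) (√-approx-isCauchy (approx x) (cauchy x))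

------------------------------------------------------------------------
-- π and the natural logarithm

partialSum : (ℕ → ℚ) → ℕ → ℚ
partialSum f zero    = 0ℚ
partialSum f (suc n) = partialSum f n + f n

private

  -- x increases while x i + 1 / (i + 1) decreases
  nested⇒Cauchy : (x : ℕ → ℚ) → (∀ i → x i ℚ.≤ x (suc i)) →
    (∀ i → x (suc i) + + 1 / suc (suc i) ℚ.≤ x i + + 1 / suc i) → IsCauchy x
  nested⇒Cauchy x up down ε 0<ε = N , bound
    where
    N = proj₁ (archimedean ε 0<ε)

    y : ℕ → ℚ
    y i = x i + + 1 / suc i

    incr : ∀ {m n} → m ℕ.≤′ n → x m ℚ.≤ x n
    incr ℕ.≤′-refl = ℚ.≤-refl
    incr {n = suc n} (ℕ.≤′-step le) = ℚ.≤-trans (incr le) (up n)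

    decr : ∀ {m n} → m ℕ.≤′ n → y n ℚ.≤ y m
    decr ℕ.≤′-refl = ℚ.≤-refl
    decr {n = suc n} (ℕ.≤′-step le) = ℚ.≤-trans (down n) (decr le)

    bound : ∀ m n → N ℕ.≤ m → N ℕ.≤ n → x m ℚ.≤ x n + ε
    bound m n N≤m N≤n = begin
      x m              ≡⟨ ℚ.+-identityʳ (x m) ⟨
      x m + 0ℚ         ≤⟨ ℚ.+-monoʳ-≤ (x m) (/-mono-≤ 0 1 1 (suc m) ℕ.z≤n) ⟩
      y m              ≤⟨ decr (ℕ.≤⇒≤′ N≤m) ⟩
      y N              ≤⟨ ℚ.+-mono-≤ (incr (ℕ.≤⇒≤′ N≤n)) (proj₂ (archimedean ε 0<ε)) ⟩
      x n + ε          ∎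
      where open ℚ.≤-Reasoning

-- Leibniz: π = 4 (1 - 1/3 + 1/5 - 1/7 + …), consecutive terms paired.
π : ℝ
π = mkℝ (λ i → partialSum term (suc i)) (nested⇒Cauchy _ up down)
  where
  term : ℕ → ℚ
  term j = + 4 / suc (4 ℕ.* j) - + 4 / (3 ℕ.+ 4 ℕ.* j)

  up : ∀ i → partialSum term (suc i) ℚ.≤ partialSum term (suc (suc i))
  up i = begin
    s                     ≡⟨ ℚ.+-identityʳ s ⟨
    s + 0ℚ                ≡⟨ cong (_+_ s) (ℚ.+-inverseʳ q) ⟨
    s + (q - q)           ≤⟨ ℚ.+-monoʳ-≤ s (ℚ.+-monoˡ-≤ (- q)
                               (/-mono-≤ 4 (3 ℕ.+ k) 4 (suc k)
                                 (ℕ.*-monoʳ-≤ 4 (ℕ.m≤n+m (suc k) 2)))) ⟩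
    s + term (suc i)      ∎
    where
    open ℚ.≤-Reasoning
    s = partialSum term (suc i)
    k = 4 ℕ.* suc i
    q = + 4 / (3 ℕ.+ k)

  down : ∀ i → partialSum term (suc (suc i)) + + 1 / suc (suc i)
               ℚ.≤ partialSum term (suc i) + + 1 / suc i
  down i = begin
    s + (p - q) + + 1 / suc (suc i)   ≤⟨ ℚ.+-mono-≤
                                           (ℚ.+-monoʳ-≤ s (ℚ.+-monoˡ-≤ (- q) p≤)) ≤q ⟩
    s + (+ 1 / suc i - q) + q         ≡⟨ eq s (+ 1 / suc i) q ⟩
    s + + 1 / suc i                   ∎
    where
    open ℚ.≤-Reasoning
    s = partialSum term (suc i)
    k = 4 ℕ.* suc i
    p = + 4 / suc k
    q = + 4 / (3 ℕ.+ k)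
    p≤ : p ℚ.≤ + 1 / suc i
    p≤ = /-mono-≤ 4 (suc k) 1 (suc i)
      (ℕ.≤-trans (ℕ.n≤1+n k) (ℕ.≤-reflexive (sym (ℕ.*-identityˡ (suc k)))))
    ≤q : + 1 / suc (suc i) ℚ.≤ q
    ≤q = /-mono-≤ 1 (suc (suc i)) 4 (3 ℕ.+ k)
      (ℕ.≤-trans (ℕ.n≤1+n _) (ℕ.≤-reflexive (e i)))
      where
      e : ∀ i → suc (1 ℕ.* (3 ℕ.+ 4 ℕ.* suc i)) ≡ 4 ℕ.* suc (suc i)
      e = solve-∀
    eq : ∀ s a q → s + (a - q) + q ≡ s + a
    eq = solve 3 (λ s a q → s :+ (a :- q) :+ q := s :+ a) refl
      where open +-*-Solver

harmonic : ℕ → ℚ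
harmonic = partialSum (λ j → + 1 / suc j)

private

  harmonic-upper : ∀ a r → harmonic (suc a ℕ.+ r) ℚ.≤ harmonic (suc a) + + r / suc a
  harmonic-upper a zero = ℚ.≤-reflexive
    (trans (cong harmonic (ℕ.+-identityʳ (suc a)))
    (trans (sym (ℚ.+-identityʳ _))
           (cong (_+_ (harmonic (suc a))) (sym (ℚ.0/n≡0 (suc a))))))
  harmonic-upper a (suc r) = begin
    harmonic (suc a ℕ.+ suc r)                           ≡⟨ cong harmonic (ℕ.+-suc (suc a) r) ⟩
    harmonic (suc a ℕ.+ r) + + 1 / suc (suc a ℕ.+ r)     ≤⟨ ℚ.+-mono-≤ (harmonic-upper a r)
        (/-mono-≤ 1 (suc (suc a ℕ.+ r)) 1 (suc a)
          (ℕ.*-monoʳ-≤ 1 (ℕ.≤-trans (ℕ.m≤m+n (suc a) r) (ℕ.n≤1+n _)))) ⟩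
    harmonic (suc a) + + r / suc a + + 1 / suc a         ≡⟨ ℚ.+-assoc (harmonic (suc a)) (+ r / suc a) (+ 1 / suc a) ⟩
    harmonic (suc a) + (+ r / suc a + + 1 / suc a)       ≡⟨ cong (_+_ (harmonic (suc a)))
        (trans (/-+ r a 1 a) (/-≡ (r ℕ.* suc a ℕ.+ 1 ℕ.* suc a) (suc a ℕ.* suc a)
                                  (suc r) (suc a) (e r (suc a)))) ⟩
    harmonic (suc a) + + suc r / suc a                   ∎
    where
    open ℚ.≤-Reasoning
    e : ∀ r a → (r ℕ.* a ℕ.+ 1 ℕ.* a) ℕ.* a ≡ suc r ℕ.* (a ℕ.* a)
    e = solve-∀

  harmonic-lower : ∀ a b r → a ℕ.+ r ℕ.≤ suc b →
                   harmonic a + + r / suc b ℚ.≤ harmonic (a ℕ.+ r)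
  harmonic-lower a b zero _ = ℚ.≤-reflexive
    (trans (cong (_+_ (harmonic a)) (ℚ.0/n≡0 (suc b)))
    (trans (ℚ.+-identityʳ _) (cong harmonic (sym (ℕ.+-identityʳ a)))))
  harmonic-lower a b (suc r) le = begin
    harmonic a + + suc r / suc b                   ≡⟨ cong (_+_ (harmonic a))
        (trans (/-≡ (suc r) (suc b) (r ℕ.* suc b ℕ.+ 1 ℕ.* suc b)
                    (suc b ℕ.* suc b) (e r (suc b)))
               (sym (/-+ r b 1 b))) ⟩
    harmonic a + (+ r / suc b + + 1 / suc b)       ≡⟨ ℚ.+-assoc (harmonic a) (+ r / suc b) (+ 1 / suc b) ⟨
    harmonic a + + r / suc b + + 1 / suc b         ≤⟨ ℚ.+-mono-≤
        (harmonic-lower a b r (ℕ.≤-trans (ℕ.n≤1+n _) le′))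
        (/-mono-≤ 1 (suc b) 1 (suc (a ℕ.+ r)) (ℕ.*-monoʳ-≤ 1 le′)) ⟩
    harmonic (a ℕ.+ r) + + 1 / suc (a ℕ.+ r)       ≡⟨ cong harmonic (ℕ.+-suc a r) ⟨
    harmonic (a ℕ.+ suc r)                         ∎
    where
    open ℚ.≤-Reasoning
    le′ : suc (a ℕ.+ r) ℕ.≤ suc b
    le′ = subst (ℕ._≤ suc b) (ℕ.+-suc a r) le
    e : ∀ r a → suc r ℕ.* (a ℕ.* a) ≡ (r ℕ.* a ℕ.+ 1 ℕ.* a) ℕ.* a
    e = solve-∀

-- ln n = ∫₁ⁿ dt/t. The right-endpoint Riemann sum with mesh 1/m is
-- ∑ (1/m) · 1/(j/m) over m < j ≤ n m, that is, harmonic (n m) - harmonic m.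
ln : (n : ℕ) → .{{NonZero n}} → ℝ
ln (suc n) = mkℝ x (nested⇒Cauchy x up down)
  where
  ν = suc n

  x : ℕ → ℚ
  x i = harmonic (ν ℕ.* suc i) - harmonic (suc i)

  step : ∀ i → ν ℕ.* suc (suc i) ≡ ν ℕ.* suc i ℕ.+ ν
  step i = trans (ℕ.*-suc ν (suc i)) (ℕ.+-comm ν (ν ℕ.* suc i))

  up : ∀ i → x i ℚ.≤ x (suc i)
  up i = begin
    h - g               ≡⟨ eq h g t ⟩
    h + t - (g + t)     ≤⟨ ℚ.+-monoˡ-≤ (- (g + t)) le ⟩
    harmonic (ν ℕ.* suc (suc i)) - (g + t)   ∎
    where
    open ℚ.≤-Reasoning
    h = harmonic (ν ℕ.* suc i)
    g = harmonic (suc i)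
    t = + 1 / suc (suc i)
    le : h + t ℚ.≤ harmonic (ν ℕ.* suc (suc i))
    le = subst₂ ℚ._≤_
      (cong (_+_ h) (/-≡ ν (ν ℕ.* suc (suc i)) 1 (suc (suc i))
        (sym (ℕ.*-identityˡ (ν ℕ.* suc (suc i))))))
      (cong harmonic (sym (step i)))
      (harmonic-lower (ν ℕ.* suc i) _ ν (ℕ.≤-reflexive (sym (step i))))
    eq : ∀ h g t → h - g ≡ h + t - (g + t)
    eq = solve 3 (λ h g t → h :- g := h :+ t :- (g :+ t)) refl
      where open +-*-Solver

  down : ∀ i → x (suc i) + + 1 / suc (suc i) ℚ.≤ x i + + 1 / suc i
  down i = begin
    harmonic (ν ℕ.* suc (suc i)) - (g + t) + t   ≤⟨ ℚ.+-monoˡ-≤ t (ℚ.+-monoˡ-≤ (- (g + t)) le) ⟩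
    h + u - (g + t) + t                          ≡⟨ eq h g t u ⟩
    h - g + u                                    ∎
    where
    open ℚ.≤-Reasoning
    h = harmonic (ν ℕ.* suc i)
    g = harmonic (suc i)
    t = + 1 / suc (suc i)
    u = + 1 / suc i
    le : harmonic (ν ℕ.* suc (suc i)) ℚ.≤ h + u
    le = subst₂ ℚ._≤_
      (cong harmonic (sym (step i)))
      (cong (_+_ h) (/-≡ ν (ν ℕ.* suc i) 1 (suc i)
        (sym (ℕ.*-identityˡ (ν ℕ.* suc i)))))
      (harmonic-upper (i ℕ.+ n ℕ.* suc i) ν)
    eq : ∀ h g t u → h + u - (g + t) + t ≡ h - g + u
    eq = solve 4 (λ h g t u → h :+ u :- (g :+ t) :+ t := h :- g :+ u) refl
      where open +-*-Solver

------------------------------------------------------------------------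
-- Ceilings and o(1)

-- Ceilings of reals are not computable, hence a relation. It determines
-- k, and the reals it is used for here are nonnegative.
IsCeiling : ℕ → ℝ → Set
IsCeiling k x = fromℚ (fromℕ k - 1ℚ) < x × x ≤ fromℚ (fromℕ k)

Vanishing : (ℕ → ℚ) → Set
Vanishing f = ∀ ε → 0ℚ ℚ.< ε → ∃[ N ] (∀ n → N ℕ.≤ n → ℚ.∣ f n ∣ ℚ.≤ ε)

------------------------------------------------------------------------
-- Random automata

Letter : Set
Letter = Fin 2

pattern a = zero
pattern b = suc zero

Automaton : ℕ → Set
Automaton n = Fin n → Letter → Fin n

δ⟨_⟩ : ∀ {n} → List Letter → Automaton n → Fin n → Fin n
δ⟨ ω ⟩ δ x = foldl δ x ω

image : ∀ {n} → (Fin n → Fin n) → Subset n → Subset n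
image f B = tabulate λ y → does (any? λ x → (x ∈? B) ×-dec (f x Fin.≟ y))

-- Every transition function is enumerated exactly once: finToFun is a
-- bijection from Fin (n ^ (n * 2)) to the functions Fin (n * 2) → Fin n
-- (up to pointwise equality), and combine one from Fin n × Fin 2 to Fin (n * 2).
automaton : ∀ n → Fin (n ℕ.^ (n ℕ.* 2)) → Automaton n
automaton n i x c = finToFun i (combine x c)

-- Expectation with respect to the uniform distribution on automata.
𝔼 : ∀ n .{{_ : NonZero n}} → (Automaton n → ℕ) → ℚ
𝔼 n X = _/_ (+ sum (λ i → X (automaton n i))) (n ℕ.^ (n ℕ.* 2))
            {{ℕ.m^n≢0 n (n ℕ.* 2)}}

{-# OPTIONS --safe #-}

-- Let f be the random map x ↦ δ x a, and let p j be the probability that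
-- x, f x, …, f^j x are distinct, so that p (j + 1) = (1 - (j + 1) / n) p j.
-- A state in the image of f^k either lies on a cycle of length at most k or
-- ends a path of k + 1 distinct states, hence
--
--   E |A| ≤ ∑_{j < k} p j + n p k.
--
-- Since (j + 1) p j = n (p j - p (j + 1)), the terms j ≥ m sum to at most
-- n / (m + 1), and m = ⌊√ n⌋ bounds the sum by 2 m + 1. Halving p repeatedly,
-- first every √ n steps, then every √ n / 2, √ n / 3, … steps, gives
-- n p k ≤ m / 4 for large n; here ln n is only compared with the harmonic
-- lower bound ⌊log₂ n⌋ / 2. As 2 + 1/4 < √ 6 ≤ √ (2 π), the error term can be
-- taken to be 0 for all large n.
module Submission where

import Data.Nat.Properties as ℕ

-- The sum of the p j is asymptotic to √ (π n / 2), half of the bound to be proved. This factor 2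
-- makes it affordable to bound each of the first √ n terms by 1, instead of following the Gaussian
-- decay of p.
--
-- For n p k it would not do to halve p every √ n steps throughout: only about 2 √ (ln n) such
-- intervals fit below k, whereas p k has to drop below 1 / (4 √ n), which takes about (log₂ n) / 2
-- halvings. Around j ≈ r √ n, however, about √ n / r steps halve p, so the r-th interval
-- contributes about r halvings, and their total grows like the square of the number of intervals.
-- The k of the theorem makes p k ≈ n⁻², far below what is required; this is why halving and a crude
-- lower bound for ln n are precise enough.
--
-- The counting stays in ℕ: probabilities are multiplied by the number of automata, and inequalities
-- with square roots are squared.

module Counting where

  open import Algebra.Properties.Semiring.Sum ℕ.+-*-semiring
    using (sum; sum-cong-≗; ∑-distrib-+; ∑-comm; *-distribˡ-sum; *-distribʳ-sum; sum-replicate-zero)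
  open import Data.Bool.Base using (Bool; true; false; if_then_else_)
  open import Data.Fin.Base using (Fin; zero; suc; toℕ; fromℕ<; combine; finToFun; _↑ˡ_; _↑ʳ_)
  open import Data.Fin.Properties
    using (_≟_; any?; all?; ¬∀⟶∃¬; toℕ-fromℕ<; toℕ-injective; toℕ<n; suc-injective; remQuot-combine; combine-injectiveˡ)
  open import Data.Fin.Subset using (∣_∣; ⊤; _∈_)
  open import Data.Fin.Subset.Properties using (_∈?_)
  open import Data.List.Base using (replicate)
  open import Data.Nat.Base
  open import Data.Nat.GeneralisedArithmetic using (fold; fold-+; iterate; iterate-is-fold)
  open import Data.Nat.Induction using (<-rec)
  open import Data.Nat.Properties hiding (_≟_; suc-injective)
  open import Data.Nat.Tactic.RingSolver using (solve-∀)
  open import Data.Product.Base using (Σ-syntax; ∃; _×_; _,_; proj₁; proj₂)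
  open import Data.Vec.Base using (tabulate)
  open import Data.Vec.Functional using (_∷_)
  open import Defs using (Automaton; automaton; δ⟨_⟩; image; a)
  open import Function.Base using (_∘_)
  open import Function.Definitions using (Injective)
  open import Relation.Binary.Definitions using (tri<; tri≈; tri>)
  open import Relation.Binary.PropositionalEquality
  open import Relation.Nullary
  open import Relation.Nullary.Decidable using (_×-dec_; _→-dec_)

  private variable
    m n : ℕ
    P Q : Set

  -- Finite sums and indicators

  sum-mono-≤ : {f g : Fin n → ℕ} → (∀ i → f i ≤ g i) → sum f ≤ sum g
  sum-mono-≤ {zero}  f≤g = z≤n
  sum-mono-≤ {suc n} f≤g = +-mono-≤ (f≤g zero) (sum-mono-≤ (f≤g ∘ suc))

  sum-const : ∀ n x → sum {n} (λ _ → x) ≡ n * x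
  sum-const zero    x = refl
  sum-const (suc n) x = cong (x +_) (sum-const n x)

  term≤sum : (f : Fin n → ℕ) (i : Fin n) → f i ≤ sum f
  term≤sum f zero    = m≤m+n _ _
  term≤sum f (suc i) = ≤-trans (term≤sum (f ∘ suc) i) (m≤n+m _ (f zero))

  sum-++ : ∀ m (f : Fin (m + n) → ℕ) → sum f ≡ sum (λ i → f (i ↑ˡ n)) + sum (λ j → f (m ↑ʳ j))
  sum-++ zero    f = refl
  sum-++ (suc m) f = trans (cong (f zero +_) (sum-++ m (f ∘ suc))) (sym (+-assoc (f zero) _ _))

  sum-combine : ∀ m (f : Fin (m * n) → ℕ) → sum f ≡ sum {m} λ i → sum {n} λ j → f (combine i j)
  sum-combine         zero    f = refl
  sum-combine {n = n} (suc m) f = trans (sum-++ n f) (cong (sum {n} (λ i → f (i ↑ˡ (m * n))) +_) (sum-combine m (λ j → f (n ↑ʳ j))))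

  ⟦_⟧ : Dec P → ℕ
  ⟦ P? ⟧ = if does P? then 1 else 0

  ⟦⟧-cong : (P → Q) → (Q → P) → (P? : Dec P) (Q? : Dec Q) → ⟦ P? ⟧ ≡ ⟦ Q? ⟧
  ⟦⟧-cong P⇒Q Q⇒P (yes _) (yes _) = refl
  ⟦⟧-cong P⇒Q Q⇒P (yes p) (no ¬q) = contradiction (P⇒Q p) ¬q
  ⟦⟧-cong P⇒Q Q⇒P (no ¬p) (yes q) = contradiction (Q⇒P q) ¬p
  ⟦⟧-cong P⇒Q Q⇒P (no _)  (no _)  = refl

  ⟦×⟧ : (P? : Dec P) (Q? : Dec Q) → ⟦ P? ×-dec Q? ⟧ ≡ ⟦ P? ⟧ * ⟦ Q? ⟧
  ⟦×⟧ (yes _) (yes _) = refl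
  ⟦×⟧ (yes _) (no _)  = refl
  ⟦×⟧ (no _)  Q?      = refl

  ⟦⟧≡1 : (P? : Dec P) → P → ⟦ P? ⟧ ≡ 1
  ⟦⟧≡1 (yes _) _ = refl
  ⟦⟧≡1 (no ¬p) p = contradiction p ¬p

  sum-≟ : ∀ (x : Fin n) (h : Fin n → ℕ) → sum (λ q → ⟦ x ≟ q ⟧ * h q) ≡ h x
  sum-≟ {suc n} zero    h = trans (cong₂ _+_ (+-identityʳ (h zero)) (sum-replicate-zero n)) (+-identityʳ (h zero))
  sum-≟ {suc n} (suc x) h = sum-≟ x (h ∘ suc)

  sum-≟-injective : ∀ (y : Fin n) (x : Fin m → Fin n) → Injective _≡_ _≡_ x → sum (λ i → ⟦ y ≟ x i ⟧) ≤ 1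
  sum-≟-injective {m = zero}  y x inj = z≤n
  sum-≟-injective {m = suc m} y x inj with y ≟ x zero
  ... | no  _    = sum-≟-injective y (x ∘ suc) λ eq → suc-injective (inj eq)
  ... | yes refl = ≤-reflexive (cong suc (trans (sum-cong-≗ none) (sum-replicate-zero m)))
    where
    none : ∀ i → ⟦ x zero ≟ x (suc i) ⟧ ≡ 0
    none i with x zero ≟ x (suc i)
    ... | no  _  = refl
    ... | yes eq with () ← inj eq

  -- Independence of the values of a uniformly random function

  AgreeOff : Fin m → (F G : Fin m → Fin n) → Set
  AgreeOff c F G = ∀ d → d ≢ c → F d ≡ G d

  finToFun-combine : ∀ m (z : Fin n) ω → finToFun {n} {suc m} (combine z ω) ≗ z ∷ finToFun ω
  finToFun-combine m z ω zero    = cong proj₁ (remQuot-combine z ω)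
  finToFun-combine m z ω (suc d) = cong (λ p → finToFun (proj₂ p) d) (remQuot-combine z ω)

  -- The congruence hypothesis stands in for function extensionality: `finToFun (combine z ω)` and
  -- `z ∷ finToFun ω` agree only pointwise.
  sum-finToFun : ∀ m (K : (Fin (suc m) → Fin n) → ℕ) → (∀ {F G} → F ≗ G → K F ≡ K G) →
                 sum (λ ω → K (finToFun ω)) ≡ sum λ z → sum λ ω → K (z ∷ finToFun ω)
  sum-finToFun {n} m K K-cong = trans (sum-combine n _)
    (sum-cong-≗ λ z → sum-cong-≗ λ ω → K-cong (finToFun-combine m z ω))

  -- Since `K` ignores the coordinate `c`, the condition that this coordinate be `r` keeps exactly
  -- one in `n` of the functions that differ only there. Leading coordinates are split off until `c`
  -- is the first.
  sum-resample : ∀ (c : Fin m) (r : Fin n) (K : (Fin m → Fin n) → ℕ) →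
                 (∀ {F G} → AgreeOff c F G → K F ≡ K G) →
                 n * sum (λ ω → K (finToFun ω) * ⟦ finToFun ω c ≟ r ⟧) ≡ sum (λ ω → K (finToFun ω))
  sum-resample {suc m} {n} c r K K-inv = begin
    n * sum (λ ω → K (finToFun ω) * ⟦ finToFun ω c ≟ r ⟧)
      ≡⟨ cong (n *_) (sum-finToFun m (λ F → K F * ⟦ F c ≟ r ⟧)
           λ F≗G → cong₂ (λ k y → k * ⟦ y ≟ r ⟧) (K-inv (λ d _ → F≗G d)) (F≗G c)) ⟩
    n * sum (λ z → sum λ ω → K (z ∷ finToFun ω) * ⟦ (z ∷ finToFun ω) c ≟ r ⟧)
      ≡⟨ step c K-inv ⟩
    sum (λ z → sum λ ω → K (z ∷ finToFun ω))
      ≡⟨ sum-finToFun m K (λ F≗G → K-inv (λ d _ → F≗G d)) ⟨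
    sum (λ ω → K (finToFun ω)) ∎
    where
    open ≡-Reasoning
    step : ∀ c → (∀ {F G} → AgreeOff c F G → K F ≡ K G) →
           n * sum (λ z → sum λ ω → K (z ∷ finToFun ω) * ⟦ (z ∷ finToFun ω) c ≟ r ⟧)
           ≡ sum (λ z → sum λ ω → K (z ∷ finToFun ω))
    step zero K-inv = begin
      n * sum (λ z → sum λ ω → K (z ∷ finToFun ω) * ⟦ z ≟ r ⟧)
        ≡⟨ cong (n *_) (sum-cong-≗ λ z → sym (*-distribʳ-sum ⟦ z ≟ r ⟧ (λ ω → K (z ∷ finToFun ω)))) ⟩
      n * sum (λ z → A z * ⟦ z ≟ r ⟧)
        ≡⟨ cong (n *_) (sum-cong-≗ λ z → trans (*-comm (A z) _)
             (cong (_* A z) (⟦⟧-cong sym sym (z ≟ r) (r ≟ z)))) ⟩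
      n * sum (λ z → ⟦ r ≟ z ⟧ * A z)  ≡⟨ cong (n *_) (sum-≟ r A) ⟩
      n * A r                          ≡⟨ sum-const n (A r) ⟨
      sum {n} (λ _ → A r)              ≡⟨ sum-cong-≗ (λ z → sum-cong-≗ λ ω → K-inv (off z ω)) ⟩
      sum A                            ∎
      where
      A : Fin n → ℕ
      A z = sum λ ω → K (z ∷ finToFun {n} {m} ω)
      off : ∀ z ω → AgreeOff zero (r ∷ finToFun ω) (z ∷ finToFun ω)
      off z ω zero    0≢0 = contradiction refl 0≢0
      off z ω (suc d) _   = refl
    step (suc c) K-inv = trans
      (*-distribˡ-sum n (λ z → sum λ ω → K (z ∷ finToFun ω) * ⟦ finToFun ω c ≟ r ⟧))
      (sum-cong-≗ λ z → sum-resample c r (λ F → K (z ∷ F)) λ F~G → K-inv (off z F~G))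
      where
      off : ∀ z {F G} → AgreeOff c F G → AgreeOff (suc c) (z ∷ F) (z ∷ G)
      off z F~G zero    _   = refl
      off z F~G (suc d) d≢c = F~G d (d≢c ∘ cong suc)

  -- Paths of distinct iterates

  Distinct : (Fin n → Fin n) → Fin n → ℕ → Set
  Distinct f x j = ∀ (i i′ : Fin (suc j)) → fold x f (toℕ i) ≡ fold x f (toℕ i′) → i ≡ i′

  distinct? : ∀ (f : Fin n → Fin n) x j → Dec (Distinct f x j)
  distinct? f x j = all? λ i → all? λ i′ → (fold x f (toℕ i) ≟ fold x f (toℕ i′)) →-dec (i ≟ i′)

  module _ {f : Fin n → Fin n} {x : Fin n} where

    distinct⇒≡ : ∀ {j} → Distinct f x j → ∀ {i i′} → i ≤ j → i′ ≤ j →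
                 fold x f i ≡ fold x f i′ → i ≡ i′
    distinct⇒≡ inj i≤j i′≤j eq = trans (sym (toℕ-fromℕ< (s≤s i≤j))) (trans
      (cong toℕ (inj _ _ (trans (cong (fold x f) (toℕ-fromℕ< (s≤s i≤j)))
        (trans eq (cong (fold x f) (sym (toℕ-fromℕ< (s≤s i′≤j))))))))
      (toℕ-fromℕ< (s≤s i′≤j)))

    ≡⇒distinct : ∀ {j} → (∀ {i i′} → i ≤ j → i′ ≤ j → fold x f i ≡ fold x f i′ → i ≡ i′) →
                 Distinct f x j
    ≡⇒distinct inj i i′ eq = toℕ-injective (inj (≤-pred (toℕ<n i)) (≤-pred (toℕ<n i′)) eq)

    distinct-pred : ∀ {j} → Distinct f x (suc j) → Distinct f x j
    distinct-pred inj = ≡⇒distinct λ i≤j i′≤j → distinct⇒≡ inj (m≤n⇒m≤1+n i≤j) (m≤n⇒m≤1+n i′≤j)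

    collision : ∀ j → ¬ Distinct f x j →
                Σ[ i ∈ ℕ ] Σ[ i′ ∈ ℕ ] i < i′ × i′ ≤ j × fold x f i ≡ fold x f i′
    collision j ¬inj
      with i  , ¬inj-i ← ¬∀⟶∃¬ (suc j) _
                           (λ i → all? λ i′ → (fold x f (toℕ i) ≟ fold x f (toℕ i′)) →-dec (i ≟ i′)) ¬inj
      with i′ , ¬inj-ii′ ← ¬∀⟶∃¬ (suc j) _ (λ i′ → (fold x f (toℕ i) ≟ fold x f (toℕ i′)) →-dec (i ≟ i′)) ¬inj-i
      with fold x f (toℕ i) ≟ fold x f (toℕ i′)
    ... | no neq = contradiction (λ eq → contradiction eq neq) ¬inj-ii′
    ... | yes eq with <-cmp (toℕ i) (toℕ i′)
    ... | tri< i<i′ _ _ = toℕ i , toℕ i′ , i<i′ , ≤-pred (toℕ<n i′) , eq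
    ... | tri≈ _ i≡i′ _ = contradiction (λ _ → toℕ-injective i≡i′) ¬inj-ii′
    ... | tri> _ _ i>i′ = toℕ i′ , toℕ i , i>i′ , ≤-pred (toℕ<n i) , sym eq

  -- When the points up to index `j` are distinct, the next one can repeat at most one of them, and
  -- if it repeats any, the longer path is not distinct. So the events counted on the left are
  -- disjoint.
  distinct-step : ∀ (f : Fin n → Fin n) x j →
    ⟦ distinct? f x (suc j) ⟧
      + sum {suc j} (λ i → ⟦ distinct? f x j ⟧ * ⟦ fold x f (suc j) ≟ fold x f (toℕ i) ⟧)
    ≤ ⟦ distinct? f x j ⟧
  distinct-step f x j = go (distinct? f x (suc j)) (distinct? f x j)
    where
    go : (D′ : Dec (Distinct f x (suc j))) (D : Dec (Distinct f x j)) →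
      ⟦ D′ ⟧ + sum {suc j} (λ i → ⟦ D ⟧ * ⟦ fold x f (suc j) ≟ fold x f (toℕ i) ⟧) ≤ ⟦ D ⟧
    go (yes d′) (no ¬d)  = contradiction (distinct-pred d′) ¬d
    go (no _)   (no _)   = ≤-reflexive (sum-replicate-zero (suc j))
    go (no _)   (yes d)  = ≤-trans (≤-reflexive (sum-cong-≗ {suc j} λ i → +-identityʳ ⟦ fold x f (suc j) ≟ fold x f (toℕ i) ⟧))
      (sum-≟-injective (fold x f (suc j)) (λ (i : Fin (suc j)) → fold x f (toℕ i)) (d _ _))
    go (yes d′) (yes _)  = ≤-reflexive (cong suc (trans (sum-cong-≗ {suc j} new) (sum-replicate-zero (suc j))))
      where
      new : ∀ i → ⟦ fold x f (suc j) ≟ fold x f (toℕ i) ⟧ + 0 ≡ 0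
      new i with fold x f (suc j) ≟ fold x f (toℕ i)
      ... | no _   = refl
      ... | yes eq = contradiction (sym (distinct⇒≡ d′ ≤-refl (<⇒≤ (toℕ<n i)) eq)) (<⇒≢ (toℕ<n i))

  -- A path of distinct points that ends in q has not used the value at q yet.
  fold-agree : ∀ {f g : Fin n → Fin n} {x q j} → (∀ y → y ≢ q → f y ≡ g y) →
               Distinct f x j → fold x f j ≡ q → ∀ i → i ≤ j → fold x f i ≡ fold x g i
  fold-agree f~g d eq zero    _   = refl
  fold-agree {f = f} {g} {x} f~g d eq (suc i) i<j = trans
    (f~g (fold x f i) λ eq′ → contradiction (distinct⇒≡ d (<⇒≤ i<j) ≤-refl (trans eq′ (sym eq))) (<⇒≢ i<j))
    (cong g (fold-agree f~g d eq i (<⇒≤ i<j)))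

  -- Read from right to left, this splits a count according to the values of `x` and `y`.
  sum-≟² : ∀ c (x y : Fin n) (h : Fin n → Fin n → ℕ) →
           sum (λ q → sum λ r → c * (⟦ x ≟ q ⟧ * ⟦ y ≟ r ⟧) * h q r) ≡ c * h x y
  sum-≟² c x y h = begin
    sum (λ q → sum λ r → c * (⟦ x ≟ q ⟧ * ⟦ y ≟ r ⟧) * h q r)
      ≡⟨ sum-cong-≗ (λ q → sum-cong-≗ λ r → reorder c ⟦ x ≟ q ⟧ ⟦ y ≟ r ⟧ (h q r)) ⟩
    sum (λ q → sum λ r → ⟦ y ≟ r ⟧ * (⟦ x ≟ q ⟧ * (c * h q r)))
      ≡⟨ sum-cong-≗ (λ q → sum-≟ y λ r → ⟦ x ≟ q ⟧ * (c * h q r)) ⟩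
    sum (λ q → ⟦ x ≟ q ⟧ * (c * h q y))
      ≡⟨ sum-≟ x (λ q → c * h q y) ⟩
    c * h x y ∎
    where
    open ≡-Reasoning
    reorder : ∀ c u v h → c * (u * v) * h ≡ v * (u * (c * h))
    reorder = solve-∀

  ∑-comm₃ : ∀ {k l m} (f : Fin k → Fin l → Fin m → ℕ) →
            sum (λ ω → sum λ q → sum λ r → f ω q r) ≡ sum (λ q → sum λ r → sum λ ω → f ω q r)
  ∑-comm₃ f = trans (∑-comm λ ω q → sum (f ω q)) (sum-cong-≗ λ q → ∑-comm λ ω r → f ω q r)

  -- The value of a random function at the end of a path of distinct points is
  -- uniform and independent of the path, so it closes up at any prescribed
  -- point of the path with probability 1 / n.
  module _ (ι : Fin n → Fin m) (ι-injective : Injective _≡_ _≡_ ι) where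

    private
      map-of : Fin (n ^ m) → Fin n → Fin n
      map-of ω = finToFun ω ∘ ι

    sum-return : ∀ x {i j} → i ≤ j →
      n * sum (λ ω → ⟦ distinct? (map-of ω) x j ⟧
                     * ⟦ fold x (map-of ω) (suc j) ≟ fold x (map-of ω) i ⟧)
      ≡ sum (λ ω → ⟦ distinct? (map-of ω) x j ⟧)
    sum-return x {i} {j} i≤j = begin
      n * sum (λ ω → D ω * ⟦ fold x (map-of ω) (suc j) ≟ fold x (map-of ω) i ⟧)
        -- The point at which the next value is taken is itself random. Fixing the end `q` of the
        -- path and its point `r` of index `i` turns the return into a condition on the single
        -- coordinate `ι q`, to which `sum-resample` applies.
        ≡⟨ cong (n *_) (trans (sum-cong-≗ λ ω → expand ω (λ q r → ⟦ map-of ω q ≟ r ⟧))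
             (∑-comm₃ λ ω q r → K q r (finToFun ω) * ⟦ map-of ω q ≟ r ⟧)) ⟩
      n * sum (λ q → sum λ r → sum λ ω → K q r (finToFun ω) * ⟦ map-of ω q ≟ r ⟧)
        ≡⟨ trans (*-distribˡ-sum n λ q → sum λ r → sum λ ω → K q r (finToFun ω) * ⟦ map-of ω q ≟ r ⟧)
             (sum-cong-≗ λ q → *-distribˡ-sum n λ r → sum λ ω → K q r (finToFun ω) * ⟦ map-of ω q ≟ r ⟧) ⟩
      sum (λ q → sum λ r → n * sum λ ω → K q r (finToFun ω) * ⟦ map-of ω q ≟ r ⟧)
        ≡⟨ sum-cong-≗ (λ q → sum-cong-≗ λ r → sum-resample (ι q) r (K q r) (K-invariant q r)) ⟩
      sum (λ q → sum λ r → sum λ ω → K q r (finToFun ω))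
        ≡⟨ ∑-comm₃ (λ ω q r → K q r (finToFun ω)) ⟨
      sum (λ ω → sum λ q → sum λ r → K q r (finToFun ω))
        ≡⟨ sum-cong-≗ (λ ω → trans (sum-cong-≗ λ q → sum-cong-≗ λ r → sym (*-identityʳ (K q r (finToFun ω))))
             (trans (sym (expand ω λ _ _ → 1)) (*-identityʳ (D ω)))) ⟩
      sum D ∎
      where
      open ≡-Reasoning

      D : Fin (n ^ m) → ℕ
      D ω = ⟦ distinct? (map-of ω) x j ⟧

      Event : Fin n → Fin n → (Fin m → Fin n) → Set
      Event q r F = Distinct (F ∘ ι) x j × fold x (F ∘ ι) j ≡ q × fold x (F ∘ ι) i ≡ r

      event? : ∀ q r F → Dec (Event q r F)
      event? q r F = distinct? (F ∘ ι) x j ×-dec fold x (F ∘ ι) j ≟ q ×-dec fold x (F ∘ ι) i ≟ r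

      K : Fin n → Fin n → (Fin m → Fin n) → ℕ
      K q r F = ⟦ event? q r F ⟧

      transfer : ∀ {q r F G} → AgreeOff (ι q) F G → Event q r F → Event q r G
      transfer {q} {r} {F} {G} F~G (d , j↦q , i↦r) =
        (λ h h′ eq → d h h′ (trans (same (≤-pred (toℕ<n h))) (trans eq (sym (same (≤-pred (toℕ<n h′))))))) ,
        trans (sym (same ≤-refl)) j↦q , trans (sym (same i≤j)) i↦r
        where
        same : ∀ {h} → h ≤ j → fold x (F ∘ ι) h ≡ fold x (G ∘ ι) h
        same = fold-agree (λ y y≢q → F~G (ι y) (y≢q ∘ ι-injective)) d j↦q _

      K-invariant : ∀ q r {F G} → AgreeOff (ι q) F G → K q r F ≡ K q r G
      K-invariant q r {F} {G} F~G =
        ⟦⟧-cong (transfer F~G) (transfer λ d d≢ → sym (F~G d d≢)) (event? q r F) (event? q r G)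

      expand : ∀ ω (h : Fin n → Fin n → ℕ) →
        D ω * h (fold x (map-of ω) j) (fold x (map-of ω) i) ≡ sum λ q → sum λ r → K q r (finToFun ω) * h q r
      expand ω h = trans (sym (sum-≟² (D ω) (fold x (map-of ω) j) (fold x (map-of ω) i) h))
        (sum-cong-≗ λ q → sum-cong-≗ λ r → cong (_* h q r) (sym (trans
          (⟦×⟧ (distinct? (map-of ω) x j) (fold x (map-of ω) j ≟ q ×-dec fold x (map-of ω) i ≟ r))
          (cong (D ω *_) (⟦×⟧ (fold x (map-of ω) j ≟ q) (fold x (map-of ω) i ≟ r))))))

  -- Cycles and the image of an iterate

  reduce-period : ∀ (f : Fin n → Fin n) x p → fold x f (suc p) ≡ x →
                  Σ[ p′ ∈ ℕ ] p′ ≤ p × Distinct f x p′ × fold x f (suc p′) ≡ x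
  reduce-period f x = <-rec Goal λ p reduce → go p reduce (distinct? f x p)
    where
    open ≡-Reasoning
    Goal : ℕ → Set
    Goal p = fold x f (suc p) ≡ x → Σ[ p′ ∈ ℕ ] p′ ≤ p × Distinct f x p′ × fold x f (suc p′) ≡ x
    go : ∀ p → (∀ {p′} → p′ < p → Goal p′) → Dec (Distinct f x p) → Goal p
    go p reduce (yes d) periodic = p , ≤-refl , d , periodic
    go p reduce (no ¬d) periodic
      -- Cutting out the loop between the equal points of index `i` and `i′` leaves a shorter return
      -- to `x`, in `suc e + i` steps.
      with i , i′ , i<i′ , i′≤p , eq ← collision p ¬d
      with e ← p ∸ i′ | refl ← m∸n+n≡m i′≤p
      with p′ , p′≤ , d , periodic′ ← reduce (+-monoʳ-< e i<i′) (begin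
        fold x f (suc e + i)             ≡⟨ fold-+ x f (suc e) ⟩
        fold (fold x f i) f (suc e)      ≡⟨ cong (λ y → fold y f (suc e)) eq ⟩
        fold (fold x f i′) f (suc e)     ≡⟨ fold-+ x f (suc e) ⟨
        fold x f (suc e + i′)            ≡⟨ periodic ⟩
        x                                ∎)
      = p′ , ≤-trans p′≤ (+-monoʳ-≤ e (<⇒≤ i<i′)) , d , periodic′

  -- From the first of the two equal points on, the path has period i′ - i = p + 1, and index `k` is
  -- not before either of them.
  collision⇒periodic : ∀ (f : Fin n → Fin n) y k → ¬ Distinct f y k →
                       Σ[ p ∈ ℕ ] p < k × fold (fold y f k) f (suc p) ≡ fold y f k
  collision⇒periodic f y k ¬d
    with i , i′ , i<i′ , i′≤k , eq ← collision k ¬d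
    with e ← k ∸ i′ | refl ← m∸n+n≡m i′≤k
    with p ← i′ ∸ suc i | refl ← m∸n+n≡m i<i′
    = p , ≤-trans (m≤m+n (suc p) i) (≤-trans (≤-reflexive (sym (+-suc p i))) (m≤n+m _ e)) , (begin
      fold (fold y f (e + (p + suc i))) f (suc p)    ≡⟨ fold-+ y f (suc p) ⟨
      fold y f (suc p + (e + (p + suc i)))           ≡⟨ cong (fold y f) (shift p e (p + suc i)) ⟩
      fold y f (e + suc p + (p + suc i))             ≡⟨ fold-+ y f (e + suc p) ⟩
      fold (fold y f (p + suc i)) f (e + suc p)      ≡⟨ cong (λ z → fold z f (e + suc p)) eq ⟨
      fold (fold y f i) f (e + suc p)                ≡⟨ fold-+ y f (e + suc p) ⟨
      fold y f (e + suc p + i)                       ≡⟨ cong (fold y f) (shift′ e p i) ⟩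
      fold y f (e + (p + suc i))                     ∎)
    where
    open ≡-Reasoning
    shift : ∀ p e h → suc p + (e + h) ≡ e + suc p + h
    shift = solve-∀
    shift′ : ∀ e p i → e + suc p + i ≡ e + (p + suc i)
    shift′ = solve-∀

  ∣tabulate∣≤sum : ∀ (b : Fin n → Bool) (h : Fin n → ℕ) → (∀ x → b x ≡ true → 1 ≤ h x) → ∣ tabulate b ∣ ≤ sum h
  ∣tabulate∣≤sum {zero}  b h _  = z≤n
  ∣tabulate∣≤sum {suc n} b h b≤h with b zero in eq
  ... | true  = +-mono-≤ (b≤h zero eq) (∣tabulate∣≤sum (b ∘ suc) (h ∘ suc) (b≤h ∘ suc))
  ... | false = ≤-trans (∣tabulate∣≤sum (b ∘ suc) (h ∘ suc) (b≤h ∘ suc)) (m≤n+m _ (h zero))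

  ∣image∣≤sum : ∀ (g : Fin n → Fin n) (h : Fin n → ℕ) → (∀ y → 1 ≤ h (g y)) → ∣ image g ⊤ ∣ ≤ sum h
  ∣image∣≤sum g h 1≤h = ∣tabulate∣≤sum _ h λ x → covered x (any? λ y → (y ∈? ⊤) ×-dec (g y ≟ x))
    where
    covered : ∀ x (x? : Dec (∃ λ y → y ∈ ⊤ × g y ≡ x)) → does x? ≡ true → 1 ≤ h x
    covered x (yes (y , _ , refl)) _ = 1≤h y

  δ-replicate : ∀ (δ : Automaton n) k x → δ⟨ replicate k a ⟩ δ x ≡ fold x (λ y → δ y a) k
  δ-replicate δ k x = trans (go k x) (sym (iterate-is-fold x (λ y → δ y a) k))
    where
    go : ∀ k x → δ⟨ replicate k a ⟩ δ x ≡ iterate (λ y → δ y a) x k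
    go zero    x = refl
    go (suc k) x = go k (δ x a)

  -- A state in the image of the k-th iterate lies on a cycle of length at
  -- most k, or it ends a path of k + 1 distinct states.
  ∣image-fold∣≤ : ∀ (f : Fin n → Fin n) k (g : Fin n → Fin n) → (∀ x → g x ≡ fold x f k) →
    ∣ image g ⊤ ∣
    ≤ sum (λ x → sum λ (j : Fin k) → ⟦ distinct? f x (toℕ j) ⟧ * ⟦ fold x f (suc (toℕ j)) ≟ x ⟧)
      + sum (λ y → ⟦ distinct? f y k ⟧)
  ∣image-fold∣≤ {n} f k g g≗f^k = begin
    ∣ image g ⊤ ∣                        ≤⟨ ∣image∣≤sum g h (λ y →
                                              subst (λ x → 1 ≤ h x) (sym (g≗f^k y)) (1≤h y (distinct? f y k))) ⟩
    sum h                                ≡⟨ ∑-distrib-+ cyclic tails ⟩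
    -- Paths are recorded by their start `y`. Each has exactly one end, so summing over the ends `x`
    -- first leaves `U y`.
    sum cyclic + sum tails               ≡⟨ cong (sum cyclic +_) (∑-comm λ x y → ⟦ fold y f k ≟ x ⟧ * U y) ⟩
    sum cyclic + sum (λ y → sum λ x → ⟦ fold y f k ≟ x ⟧ * U y)
                                         ≡⟨ cong (sum cyclic +_) (sum-cong-≗ λ y → sum-≟ (fold y f k) λ _ → U y) ⟩
    sum cyclic + sum U                   ∎
    where
    open ≤-Reasoning
    U cyclic tails h : Fin n → ℕ
    U y = ⟦ distinct? f y k ⟧
    cyclic x = sum λ (j : Fin k) → ⟦ distinct? f x (toℕ j) ⟧ * ⟦ fold x f (suc (toℕ j)) ≟ x ⟧
    tails x = sum λ y → ⟦ fold y f k ≟ x ⟧ * U y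
    h x = cyclic x + tails x

    1≤h : ∀ y → Dec (Distinct f y k) → 1 ≤ h (fold y f k)
    1≤h y (yes d) = ≤-trans (≤-trans
      (≤-reflexive (sym (cong₂ _*_ (⟦⟧≡1 (fold y f k ≟ fold y f k) refl) (⟦⟧≡1 (distinct? f y k) d))))
      (term≤sum (λ y′ → ⟦ fold y′ f k ≟ fold y f k ⟧ * U y′) y)) (m≤n+m _ (cyclic (fold y f k)))
    1≤h y (no ¬d)
      with p , p<k , periodic ← collision⇒periodic f y k ¬d
      with p′ , p′≤p , d , periodic′ ← reduce-period f (fold y f k) p periodic
      with j ← fromℕ< (≤-<-trans p′≤p p<k) | refl ← toℕ-fromℕ< (≤-<-trans p′≤p p<k)
      = ≤-trans (≤-trans
      (≤-reflexive (sym (cong₂ _*_ (⟦⟧≡1 (distinct? f x (toℕ j)) d) (⟦⟧≡1 (fold x f (suc (toℕ j)) ≟ x) periodic′))))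
      (term≤sum (λ (j : Fin k) → ⟦ distinct? f x (toℕ j) ⟧ * ⟦ fold x f (suc (toℕ j)) ≟ x ⟧) j))
      (m≤m+n _ (tails x))
      where x = fold y f k

  -- Totals over all automata

  module Count (n : ℕ) where

    ι : Fin n → Fin (n * 2)
    ι x = combine x a

    ι-injective : Injective _≡_ _≡_ ι
    ι-injective {x} {y} = combine-injectiveˡ x a y a

    a-map : Fin (n ^ (n * 2)) → Fin n → Fin n
    a-map ω x = automaton n ω x a

    -- This is p j multiplied by n · n ^ (n * 2), the number of pairs of a state and an automaton.
    paths : ℕ → ℕ
    paths j = sum λ x → sum λ ω → ⟦ distinct? (a-map ω) x j ⟧

    paths-0 : paths 0 ≡ n * n ^ (n * 2)
    paths-0 = trans (sum-cong-≗ λ x → trans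
      (sum-cong-≗ λ ω → ⟦⟧≡1 (distinct? (a-map ω) x 0) (trivial ω x))
      (trans (sum-const (n ^ (n * 2)) 1) (*-identityʳ _)))
      (sum-const n _)
      where
      trivial : ∀ ω x → Distinct (a-map ω) x 0
      trivial ω x zero zero _ = refl

    -- By `sum-return`, each of the `suc j` points of a path is hit by the next value in one n-th of
    -- the cases; `distinct-step` removes these cases.
    paths-suc : ∀ j → n * paths (suc j) + suc j * paths j ≤ n * paths j
    paths-suc j = begin
      n * paths (suc j) + suc j * paths j
        ≡⟨ cong₂ _+_ (*-distribˡ-sum n (C (suc j))) (*-distribˡ-sum (suc j) (C j)) ⟩
      sum (λ x → n * C (suc j) x) + sum (λ x → suc j * C j x)
        ≡⟨ ∑-distrib-+ (λ x → n * C (suc j) x) (λ x → suc j * C j x) ⟨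
      sum (λ x → n * C (suc j) x + suc j * C j x)
        ≤⟨ sum-mono-≤ step ⟩
      sum (λ x → n * C j x)
        ≡⟨ *-distribˡ-sum n (C j) ⟨
      n * paths j ∎
      where
      open ≤-Reasoning
      C : ℕ → Fin n → ℕ
      C j x = sum λ ω → ⟦ distinct? (a-map ω) x j ⟧
      back : Fin n → Fin (suc j) → Fin (n ^ (n * 2)) → ℕ
      back x i ω = ⟦ distinct? (a-map ω) x j ⟧ * ⟦ fold x (a-map ω) (suc j) ≟ fold x (a-map ω) (toℕ i) ⟧
      step : ∀ x → n * C (suc j) x + suc j * C j x ≤ n * C j x
      step x = begin
        n * C (suc j) x + suc j * C j x
          ≡⟨ cong (n * C (suc j) x +_) (sym (sum-const (suc j) (C j x))) ⟩
        n * C (suc j) x + sum {suc j} (λ i → C j x)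
          ≡⟨ cong (n * C (suc j) x +_) (sum-cong-≗ {suc j} λ i →
               sym (sum-return ι ι-injective x (≤-pred (toℕ<n i)))) ⟩
        n * C (suc j) x + sum {suc j} (λ i → n * sum (back x i))
          ≡⟨ cong (n * C (suc j) x +_) (*-distribˡ-sum n (λ i → sum (back x i))) ⟨
        n * C (suc j) x + n * sum (λ i → sum (back x i))
          ≡⟨ *-distribˡ-+ n (C (suc j) x) _ ⟨
        n * (C (suc j) x + sum (λ i → sum (back x i)))
          ≡⟨ cong (λ z → n * (C (suc j) x + z)) (∑-comm (back x)) ⟩
        n * (C (suc j) x + sum (λ ω → sum λ i → back x i ω))
          ≡⟨ cong (n *_) (∑-distrib-+ (λ ω → ⟦ distinct? (a-map ω) x (suc j) ⟧) (λ ω → sum λ i → back x i ω)) ⟨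
        n * sum (λ ω → ⟦ distinct? (a-map ω) x (suc j) ⟧ + sum λ i → back x i ω)
          ≤⟨ *-monoʳ-≤ n (sum-mono-≤ λ ω → distinct-step (a-map ω) x j) ⟩
        n * C j x ∎

    image-size : ℕ → Fin (n ^ (n * 2)) → ℕ
    image-size k ω = ∣ image (δ⟨ replicate k a ⟩ (automaton n ω)) ⊤ ∣

    sum-image-size : ∀ k → n * sum (image-size k) ≤ sum {k} (λ j → paths (toℕ j)) + n * paths k
    sum-image-size k = begin
      n * sum (image-size k)
        ≤⟨ *-monoʳ-≤ n (sum-mono-≤ λ ω → ∣image-fold∣≤ (a-map ω) k _ (δ-replicate (automaton n ω) k)) ⟩
      n * sum (λ ω → sum (λ x → sum (R ω x)) + sum (λ y → U ω y k))
        ≡⟨ cong (n *_) (∑-distrib-+ (λ ω → sum λ x → sum (R ω x)) (λ ω → sum λ y → U ω y k)) ⟩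
      n * (sum (λ ω → sum λ x → sum (R ω x)) + sum (λ ω → sum λ y → U ω y k))
        ≡⟨ cong₂ (λ u v → n * (u + v)) (∑-comm₃ R) (∑-comm λ ω y → U ω y k) ⟩
      n * (sum (λ x → sum λ j → sum λ ω → R ω x j) + paths k)
        ≡⟨ *-distribˡ-+ n _ (paths k) ⟩
      n * sum (λ x → sum λ j → sum λ ω → R ω x j) + n * paths k
        ≡⟨ cong (_+ n * paths k) (trans (*-distribˡ-sum n λ x → sum λ j → sum λ ω → R ω x j)
             (sum-cong-≗ λ x → *-distribˡ-sum n λ j → sum λ ω → R ω x j)) ⟩
      sum (λ x → sum λ j → n * sum λ ω → R ω x j) + n * paths k
        -- A cycle is a return to the point of index 0. The factor `n` on the left of the inequality
        -- cancels the 1 / n of the return, and the sum over `x` becomes `paths`.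
        ≡⟨ cong (_+ n * paths k) (sum-cong-≗ λ x → sum-cong-≗ {k} λ j →
             sum-return ι ι-injective x {0} {toℕ j} z≤n) ⟩
      sum (λ x → sum λ (j : Fin k) → sum λ ω → U ω x (toℕ j)) + n * paths k
        ≡⟨ cong (_+ n * paths k) (∑-comm λ x (j : Fin k) → sum λ ω → U ω x (toℕ j)) ⟩
      sum {k} (λ j → paths (toℕ j)) + n * paths k ∎
      where
      open ≤-Reasoning
      U : Fin (n ^ (n * 2)) → Fin n → ℕ → ℕ
      U ω x j = ⟦ distinct? (a-map ω) x j ⟧
      R : Fin (n ^ (n * 2)) → Fin n → Fin k → ℕ
      R ω x j = U ω x (toℕ j) * ⟦ fold x (a-map ω) (suc (toℕ j)) ≟ x ⟧

-- Sums and halving times of decaying sequences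

module Decaying where

  open import Algebra.Properties.Semiring.Sum ℕ.+-*-semiring using (sum)
  open import Data.Fin.Base using (toℕ)
  open import Data.Nat.Base
  open import Data.Nat.DivMod
  open import Data.Nat.Properties
  open import Data.Nat.Tactic.RingSolver using (solve-∀)
  open import Data.Product.Base using (Σ-syntax; _×_; _,_; proj₁; proj₂)
  open import Data.Sum.Base using (inj₁; inj₂)
  open import Defs using (⌊√_⌋; ⌊√⌋-spec)
  open import Function.Base using (_∘_)
  open import Relation.Binary.PropositionalEquality

  open ≤-Reasoning

  sqr-cancel-≤ : ∀ x y → x * x ≤ y * y → x ≤ y
  sqr-cancel-≤ x y x²≤y² = ≮⇒≥ λ y<x → <⇒≱ (*-mono-< y<x y<x) x²≤y²

  sqr-cancel-< : ∀ x y → x * x < y * y → x < y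
  sqr-cancel-< x y x²<y² = ≰⇒> λ y≤x → <⇒≱ x²<y² (*-mono-≤ y≤x y≤x)

  m<[1+m/n]*n : ∀ m n .{{_ : NonZero n}} → m < suc (m / n) * n
  m<[1+m/n]*n m n = begin-strict
    m                     ≡⟨ m≡m%n+[m/n]*n m n ⟩
    m % n + m / n * n     <⟨ +-monoˡ-< (m / n * n) (m%n<n m n) ⟩
    suc (m / n) * n       ∎

  -- The number 0 + 1 + ... + (r - 1) of halvings collected in the blocks with index below `r`.
  triangle : ℕ → ℕ
  triangle zero    = 0
  triangle (suc r) = r + triangle r

  2*triangle : ∀ r → 2 * triangle (suc r) ≡ suc r * r
  2*triangle zero    = refl
  2*triangle (suc r) = ≡.begin
    2 * (suc r + triangle (suc r))       ≡.≡⟨ *-distribˡ-+ 2 (suc r) (triangle (suc r)) ⟩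
    2 * suc r + 2 * triangle (suc r)     ≡.≡⟨ cong (2 * suc r +_) (2*triangle r) ⟩
    2 * suc r + suc r * r                ≡.≡⟨ collect r ⟩
    (2+ r) * suc r                       ≡.∎
    where
    module ≡ = ≡-Reasoning
    collect : ∀ r → 2 * suc r + suc r * r ≡ (2+ r) * suc r
    collect = solve-∀

  -- P j behaves like ∏ (1 - (c + i) / n) over 1 ≤ i ≤ j.
  record Decay (n c : ℕ) (P : ℕ → ℕ) : Set where
    constructor mkDecay
    field step : ∀ j → n * P (suc j) + (c + suc j) * P j ≤ n * P j

  open Decay

  -- The offset `c` exists for this: tails of a decaying sequence are again decaying, so sums can be
  -- treated by recursion on the sequence.
  decay-shift : ∀ {n c P} → Decay n c P → Decay n (suc c) (P ∘ suc)
  decay-shift {n} {c} {P} decay = mkDecay λ j →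
    subst (λ w → n * P (suc (suc j)) + w * P (suc j) ≤ n * P (suc j)) (+-suc c (suc j)) (step decay (suc j))

  tail-sum-≤ : ∀ {n c P} → Decay n c P → ∀ k → suc c * sum {k} (P ∘ toℕ) ≤ n * P 0
  tail-sum-≤ {n} {c} {P} decay zero    = ≤-trans (≤-reflexive (*-zeroʳ (suc c))) z≤n
  tail-sum-≤ {n} {c} {P} decay (suc k) = begin
    suc c * (P 0 + sum {k} (P ∘ suc ∘ toℕ))            ≡⟨ *-distribˡ-+ (suc c) (P 0) _ ⟩
    suc c * P 0 + suc c * sum {k} (P ∘ suc ∘ toℕ)
      ≤⟨ +-monoʳ-≤ (suc c * P 0) (*-monoˡ-≤ (sum {k} (P ∘ suc ∘ toℕ)) (n≤1+n (suc c))) ⟩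
    suc c * P 0 + (2+ c) * sum {k} (P ∘ suc ∘ toℕ)
      ≤⟨ +-monoʳ-≤ (suc c * P 0) (tail-sum-≤ (decay-shift decay) k) ⟩
    suc c * P 0 + n * P 1                              ≡⟨ +-comm (suc c * P 0) (n * P 1) ⟩
    n * P 1 + suc c * P 0                              ≡⟨ cong (λ w → n * P 1 + w * P 0) (+-comm 1 c) ⟩
    n * P 1 + (c + 1) * P 0                            ≤⟨ step decay 0 ⟩
    n * P 0                                            ∎

  module _ {n} {{_ : NonZero n}} where

    decay-≤ : ∀ {c P} → Decay n c P → ∀ j → P (suc j) ≤ P j
    decay-≤ {c} {P} decay j = *-cancelˡ-≤ n (≤-trans (m≤m+n (n * P (suc j)) _) (step decay j))

    -- The first `i` terms are at most `P 0` each. The rest is a sequence with offset c + i, whose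
    -- sum is at most n P 0 / (c + i + 1) by `tail-sum-≤`; multiplying by the denominator avoids the
    -- division.
    sum-≤ : ∀ {c P} → Decay n c P → ∀ i k →
            suc (c + i) * sum {k} (P ∘ toℕ) ≤ (suc (c + i) * i + n) * P 0
    sum-≤ {c} {P} decay zero k = begin
      suc (c + 0) * sum {k} (P ∘ toℕ)       ≡⟨ cong (λ w → suc w * sum {k} (P ∘ toℕ)) (+-identityʳ c) ⟩
      suc c * sum {k} (P ∘ toℕ)             ≤⟨ tail-sum-≤ decay k ⟩
      n * P 0                               ≤⟨ *-monoˡ-≤ (P 0) (m≤n+m n (suc (c + 0) * 0)) ⟩
      (suc (c + 0) * 0 + n) * P 0           ∎
    sum-≤ {c} {P} decay (suc i) zero = ≤-trans (≤-reflexive (*-zeroʳ (suc (c + suc i)))) z≤n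
    sum-≤ {c} {P} decay (suc i) (suc k) = begin
      M * (P 0 + S)                         ≡⟨ *-distribˡ-+ M (P 0) S ⟩
      M * P 0 + M * S                       ≡⟨ cong (λ w → M * P 0 + w * S) M≡ ⟩
      M * P 0 + suc (suc c + i) * S         ≤⟨ +-monoʳ-≤ (M * P 0) (sum-≤ (decay-shift decay) i k) ⟩
      M * P 0 + (suc (suc c + i) * i + n) * P 1
                                            ≡⟨ cong (λ w → M * P 0 + (w * i + n) * P 1) M≡ ⟨
      M * P 0 + (M * i + n) * P 1           ≤⟨ +-monoʳ-≤ (M * P 0) (*-monoʳ-≤ (M * i + n) (decay-≤ decay 0)) ⟩
      M * P 0 + (M * i + n) * P 0           ≡⟨ collect M i n (P 0) ⟩
      (M * suc i + n) * P 0                 ∎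
      where
      M = suc (c + suc i)
      S = sum {k} (P ∘ suc ∘ toℕ)
      M≡ : M ≡ suc (suc c + i)
      M≡ = cong suc (+-suc c i)
      collect : ∀ M i n p → M * p + (M * i + n) * p ≡ (M * suc i + n) * p
      collect = solve-∀

    module _ {P : ℕ → ℕ} (decay : Decay n 0 P) where

      decay-antitone : ∀ {i j} → i ≤ j → P j ≤ P i
      decay-antitone = go ∘ ≤⇒≤′
        where
        go : ∀ {i j} → i ≤′ j → P j ≤ P i
        go ≤′-refl       = ≤-refl
        go (≤′-step i≤j) = ≤-trans (decay-≤ decay _) (go i≤j)

      -- Each of the `ℓ` steps lowers n P by at least (j + 1) P (j + ℓ): the index factor is least
      -- at the start, the value of P at the end.
      decay-telescope : ∀ j ℓ → n * P (j + ℓ) + ℓ * suc j * P (j + ℓ) ≤ n * P j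
      decay-telescope j zero rewrite +-identityʳ j = ≤-reflexive (+-identityʳ (n * P j))
      decay-telescope j (suc ℓ) rewrite +-suc j ℓ = begin
        n * P (suc h) + suc ℓ * suc j * P (suc h)
          ≤⟨ +-monoʳ-≤ (n * P (suc h)) (*-monoʳ-≤ (suc ℓ * suc j) (decay-≤ decay h)) ⟩
        n * P (suc h) + suc ℓ * suc j * P h                          ≡⟨ split (n * P (suc h)) ℓ j (P h) ⟩
        n * P (suc h) + suc j * P h + ℓ * suc j * P h                ≤⟨ +-monoˡ-≤ (ℓ * suc j * P h) (≤-trans
                                                                          (+-monoʳ-≤ (n * P (suc h)) (*-monoˡ-≤ (P h) (s≤s (m≤m+n j ℓ))))
                                                                          (step decay h)) ⟩
        n * P h + ℓ * suc j * P h                                    ≤⟨ decay-telescope j ℓ ⟩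
        n * P j                                                      ∎
        where
        h = j + ℓ
        split : ∀ x ℓ j p → x + suc ℓ * suc j * p ≡ x + suc j * p + ℓ * suc j * p
        split = solve-∀

      halving : ∀ j ℓ → n ≤ ℓ * suc j → 2 * P (j + ℓ) ≤ P j
      halving j ℓ n≤ = *-cancelˡ-≤ n (begin
        n * (2 * p)                ≡⟨ double n p ⟩
        n * p + n * p              ≤⟨ +-monoʳ-≤ (n * p) (*-monoˡ-≤ p n≤) ⟩
        n * p + ℓ * suc j * p      ≤⟨ decay-telescope j ℓ ⟩
        n * P j                    ∎)
        where
        p = P (j + ℓ)
        double : ∀ n p → n * (2 * p) ≡ n * p + n * p
        double = solve-∀

      halvings : ∀ h j ℓ → n ≤ ℓ * suc j → 2 ^ h * P (j + h * ℓ) ≤ P j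
      halvings zero    j ℓ n≤ = ≤-reflexive (trans (+-identityʳ _) (cong P (+-identityʳ j)))
      halvings (suc h) j ℓ n≤ = begin
        2 * 2 ^ h * P (j + (ℓ + h * ℓ))      ≡⟨ cong (λ i → 2 * 2 ^ h * P i) (+-assoc j ℓ (h * ℓ)) ⟨
        2 * 2 ^ h * P (j + ℓ + h * ℓ)        ≡⟨ *-assoc 2 (2 ^ h) _ ⟩
        2 * (2 ^ h * P (j + ℓ + h * ℓ))
          ≤⟨ *-monoʳ-≤ 2 (halvings h (j + ℓ) ℓ (≤-trans n≤ (*-monoʳ-≤ ℓ (s≤s (m≤m+n j ℓ))))) ⟩
        2 * P (j + ℓ)                        ≤⟨ halving j ℓ n≤ ⟩
        P j                                  ∎

      module _ {s} (n≤s² : n ≤ s * s) where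

        -- From (r + 1) s on, s / (r + 1) + 1 steps halve P, and s steps contain r
        -- such runs.
        block : ∀ r → r * suc r ≤ s → 2 ^ r * P ((2+ r) * s) ≤ P (suc r * s)
        block r r²≤s = ≤-trans (*-monoʳ-≤ (2 ^ r) (decay-antitone end≤)) (halvings r (suc r * s) ℓ n≤)
          where
          q = s / suc r
          ℓ = suc q
          -- Rounding the run length up to q + 1 costs `r` extra steps in `r` runs. As r ≤ q they
          -- fit in the place of one more run: r (q + 1) ≤ (r + 1) q ≤ s.
          r≤q : r ≤ q
          r≤q = ≤-trans (≤-reflexive (sym (m*n/n≡m r (suc r)))) (/-monoˡ-≤ (suc r) r²≤s)
          n≤ : n ≤ ℓ * suc (suc r * s)
          n≤ = begin
            n                    ≤⟨ n≤s² ⟩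
            s * s                ≤⟨ *-monoˡ-≤ s (<⇒≤ (m<[1+m/n]*n s (suc r))) ⟩
            ℓ * suc r * s        ≡⟨ *-assoc ℓ (suc r) s ⟩
            ℓ * (suc r * s)      ≤⟨ *-monoʳ-≤ ℓ (n≤1+n (suc r * s)) ⟩
            ℓ * suc (suc r * s)  ∎
          end≤ : suc r * s + r * ℓ ≤ (2+ r) * s
          end≤ = begin
            suc r * s + r * ℓ            ≡⟨ cong (suc r * s +_) (*-suc r q) ⟩
            suc r * s + (r + r * q)      ≤⟨ +-monoʳ-≤ (suc r * s) (+-monoˡ-≤ (r * q) r≤q) ⟩
            suc r * s + suc r * q
              ≤⟨ +-monoʳ-≤ (suc r * s) (≤-trans (≤-reflexive (*-comm (suc r) q)) (m/n*n≤m s (suc r))) ⟩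
            suc r * s + s                ≡⟨ +-comm (suc r * s) s ⟩
            (2+ r) * s                   ∎

        -- Block `r` leads from (r + 1) s to (r + 2) s and halves P `r` times; no halving is claimed
        -- over the first `s` steps.
        blocks : ∀ R → R * R ≤ s → 2 ^ triangle R * P (suc R * s) ≤ P 0
        blocks zero    _    = ≤-trans (≤-reflexive (+-identityʳ _)) (decay-antitone z≤n)
        blocks (suc r) R²≤s = begin
          2 ^ (r + t) * P ((2+ r) * s)
            ≡⟨ cong (_* P ((2+ r) * s)) (trans (^-distribˡ-+-* 2 r t) (*-comm (2 ^ r) (2 ^ t))) ⟩
          2 ^ t * 2 ^ r * P ((2+ r) * s)         ≡⟨ *-assoc (2 ^ t) (2 ^ r) _ ⟩
          2 ^ t * (2 ^ r * P ((2+ r) * s))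
            ≤⟨ *-monoʳ-≤ (2 ^ t) (block r (≤-trans (*-monoˡ-≤ (suc r) (n≤1+n r)) R²≤s)) ⟩
          2 ^ t * P (suc r * s)                  ≤⟨ blocks r (≤-trans (*-mono-≤ (n≤1+n r) (n≤1+n r)) R²≤s) ⟩
          P 0                                    ∎
          where t = triangle r


  -- Explicit estimates for large n

  square≤2^ : ∀ l → 2 * (9 + l) * (2 * (9 + l)) ≤ 2 ^ (9 + l)
  square≤2^ zero    = ≤ᵇ⇒≤ 324 512 _
  square≤2^ (suc l) = begin
    2 * (10 + l) * (2 * (10 + l))                              ≤⟨ m≤m+n _ (248 + 64 * l + 4 * (l * l)) ⟩
    2 * (10 + l) * (2 * (10 + l)) + (248 + 64 * l + 4 * (l * l)) ≡⟨ eq l ⟩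
    2 * (2 * (9 + l) * (2 * (9 + l)))                          ≤⟨ *-monoʳ-≤ 2 (square≤2^ l) ⟩
    2 * 2 ^ (9 + l)                                            ∎
    where
    eq : ∀ l → 2 * (10 + l) * (2 * (10 + l)) + (248 + 64 * l + 4 * (l * l)) ≡ 2 * (2 * (9 + l) * (2 * (9 + l)))
    eq = solve-∀

  -- Here `L` is ⌊log₂ n⌋. The hypothesis on `k` is k ≥ 2 √ (n ln n) with L / 2 for ln n, squared,
  -- with a slack of 2 for the approximation of reals.
  module Asymptotic {n} {{_ : NonZero n}} {P} (decay : Decay n 0 P)
    {L} (225≤L : 225 ≤ L) (2^L≤n : 2 ^ L ≤ n) (n<2^1+L : n < 2 ^ suc L)
    {k} (2nL≤[k+2]² : 2 * (n * L) ≤ (k + 2) * (k + 2)) where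

    m s ρ : ℕ
    m = ⌊√ n ⌋
    s = suc m
    ρ = ⌊√ L ⌋

    m²≤n : m * m ≤ n
    m²≤n = proj₁ (⌊√⌋-spec n)

    n<s² : n < s * s
    n<s² = proj₂ (⌊√⌋-spec n)

    ρ²≤L : ρ * ρ ≤ L
    ρ²≤L = proj₁ (⌊√⌋-spec L)

    15≤ρ : 15 ≤ ρ
    15≤ρ = ≤-pred (sqr-cancel-< 15 (suc ρ) (≤-<-trans 225≤L (proj₂ (⌊√⌋-spec L))))

    19≤m : 19 ≤ m
    19≤m = ≤-pred (sqr-cancel-< 19 (suc m) (≤-<-trans (≤-trans (≤-trans
      (≤ᵇ⇒≤ 361 (2 ^ 225) _) (^-monoʳ-≤ 2 225≤L)) 2^L≤n) n<s²))

    -- Below, the polynomial added to f (x + z) is g (x + z) - f (x + z), whose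
    -- coefficients in z are nonnegative.
    ≤-from : ∀ {x y} (f g : ℕ → ℕ) → x ≤ y → (∀ z → f (x + z) ≤ g (x + z)) → f y ≤ g y
    ≤-from f g x≤y f≤g = subst (λ y → f y ≤ g y) (m+[n∸m]≡n x≤y) (f≤g _)

    -- The 2 in 2 n L is split as (10 / 9) (9 / 5): the first factor pays for `s` instead of √ n,
    -- the second for `5 + ρ` instead of √ L. The least `m` and `ρ` for which the two polynomial
    -- inequalities hold are 19 and 15; the latter causes the bound 225 on `L`.
    9s²≤10n : 9 * (s * s) ≤ 10 * n
    9s²≤10n = ≤-trans
      (≤-from (λ m → 9 * (suc m * suc m)) (λ m → 10 * (m * m)) 19≤m λ z →
        ≤-trans (m≤m+n _ (10 + 20 * z + z * z)) (≤-reflexive (eq z)))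
      (*-monoʳ-≤ 10 m²≤n)
      where
      eq : ∀ z → 9 * ((20 + z) * (20 + z)) + (10 + 20 * z + z * z) ≡ 10 * ((19 + z) * (19 + z))
      eq = solve-∀

    10[ρ+5]²≤18L : 10 * ((5 + ρ) * (5 + ρ)) ≤ 18 * L
    10[ρ+5]²≤18L = ≤-trans
      (≤-from (λ ρ → 10 * ((5 + ρ) * (5 + ρ))) (λ ρ → 18 * (ρ * ρ)) 15≤ρ λ z →
        ≤-trans (m≤m+n _ (50 + 140 * z + 8 * (z * z))) (≤-reflexive (eq z)))
      (*-monoʳ-≤ 18 ρ²≤L)
      where
      eq : ∀ z → 10 * ((20 + z) * (20 + z)) + (50 + 140 * z + 8 * (z * z)) ≡ 18 * ((15 + z) * (15 + z))
      eq = solve-∀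

    s²≤2m² : s * s ≤ 2 * (m * m)
    s²≤2m² = ≤-from (λ m → suc m * suc m) (λ m → 2 * (m * m)) 19≤m λ z →
        ≤-trans (m≤m+n _ (322 + 36 * z + z * z)) (≤-reflexive (eq z))
      where
      eq : ∀ z → (20 + z) * (20 + z) + (322 + 36 * z + z * z) ≡ 2 * ((19 + z) * (19 + z))
      eq = solve-∀

    -- Sixteen times the square of (2 m + 1) + m / 4 against 16 · 6 n. A remainder of m / 2 would be
    -- too large, as (5 / 2)² > 6.
    [9m+4]²≤96n : (9 * m + 4) * (9 * m + 4) ≤ 96 * n
    [9m+4]²≤96n = ≤-trans
      (≤-from (λ m → (9 * m + 4) * (9 * m + 4)) (λ m → 96 * (m * m)) 19≤m λ z →
        ≤-trans (m≤m+n _ (4031 + 498 * z + 15 * (z * z))) (≤-reflexive (eq z)))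
      (*-monoʳ-≤ 96 m²≤n)
      where
      eq : ∀ z → (9 * (19 + z) + 4) * (9 * (19 + z) + 4) + (4031 + 498 * z + 15 * (z * z)) ≡ 96 * ((19 + z) * (19 + z))
      eq = solve-∀

    -- About √ (2 L) blocks fit before `k`, while slightly more than √ L of them suffice for R (R -
    -- 1) ≥ L + 6. The gap absorbs all rounding.
    R : ℕ
    R = 3 + ρ

    R²≤2L : R * R ≤ 2 * L
    R²≤2L = ≤-trans
      (≤-from (λ ρ → (3 + ρ) * (3 + ρ)) (λ ρ → 2 * (ρ * ρ)) 15≤ρ λ z →
        ≤-trans (m≤m+n _ (126 + 24 * z + z * z)) (≤-reflexive (eq z)))
      (*-monoʳ-≤ 2 ρ²≤L)
      where
      eq : ∀ z → (18 + z) * (18 + z) + (126 + 24 * z + z * z) ≡ 2 * ((15 + z) * (15 + z))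
      eq = solve-∀

    -- Required by `blocks`: R² is of order log n, whereas s exceeds √ n.
    R²≤s : R * R ≤ s
    R²≤s = ≤-trans R²≤2L (<⇒≤ (sqr-cancel-< (2 * L) s (begin-strict
      2 * L * (2 * L)  ≤⟨ ≤-from (λ L → 2 * L * (2 * L)) (2 ^_) (≤-trans (≤ᵇ⇒≤ 9 225 _) 225≤L) square≤2^ ⟩
      2 ^ L            ≤⟨ 2^L≤n ⟩
      n                <⟨ n<s² ⟩
      s * s            ∎)))

    [1+R]s≤k : suc R * s ≤ k
    [1+R]s≤k = +-cancelʳ-≤ 2 (suc R * s) k (begin
      -- One more block pays for the slack in `k + 2`.
      suc R * s + 2          ≤⟨ +-monoʳ-≤ (suc R * s) (s≤s (≤-trans (s≤s z≤n) 19≤m)) ⟩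
      suc R * s + s          ≡⟨ +-comm (suc R * s) s ⟩
      (5 + ρ) * s            ≤⟨ sqr-cancel-≤ _ _ (*-cancelˡ-≤ 90 [5+ρ]²s²≤) ⟩
      k + 2                  ∎)
      where
      regroup : ∀ x y → 90 * (x * y * (x * y)) ≡ 10 * (x * x) * (9 * (y * y))
      regroup = solve-∀
      regroup′ : ∀ L n → 18 * L * (10 * n) ≡ 90 * (2 * (n * L))
      regroup′ = solve-∀
      [5+ρ]²s²≤ : 90 * ((5 + ρ) * s * ((5 + ρ) * s)) ≤ 90 * ((k + 2) * (k + 2))
      [5+ρ]²s²≤ = begin
        90 * ((5 + ρ) * s * ((5 + ρ) * s))            ≡⟨ regroup (5 + ρ) s ⟩
        10 * ((5 + ρ) * (5 + ρ)) * (9 * (s * s))      ≤⟨ *-mono-≤ 10[ρ+5]²≤18L 9s²≤10n ⟩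
        18 * L * (10 * n)                             ≡⟨ regroup′ L n ⟩
        90 * (2 * (n * L))                            ≤⟨ *-monoʳ-≤ 90 2nL≤[k+2]² ⟩
        90 * ((k + 2) * (k + 2))                      ∎

    -- The R blocks of length s ≈ √ n that fit before k halve P
    -- R (R - 1) / 2 ≥ L / 2 + 3 times; hence E ≥ √ (32 n).
    E : ℕ
    E = 2 ^ triangle R

    32n≤E² : 32 * n ≤ E * E
    32n≤E² = begin
      32 * n                     ≤⟨ *-monoʳ-≤ 32 (<⇒≤ n<2^1+L) ⟩
      2 ^ 5 * 2 ^ suc L          ≡⟨ ^-distribˡ-+-* 2 5 (suc L) ⟨
      2 ^ (5 + suc L)            ≤⟨ ^-monoʳ-≤ 2 6+L≤ ⟩
      2 ^ (triangle R + triangle R)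
                                 ≡⟨ ^-distribˡ-+-* 2 (triangle R) (triangle R) ⟩
      E * E                      ∎
      where
      eq : ∀ ρ → 5 + suc ρ * suc ρ + 3 * ρ ≡ (3 + ρ) * (2 + ρ)
      eq = solve-∀
      6+L≤ : 5 + suc L ≤ triangle R + triangle R
      6+L≤ = begin
        5 + suc L                      ≤⟨ +-monoʳ-≤ 5 (proj₂ (⌊√⌋-spec L)) ⟩
        5 + suc ρ * suc ρ              ≤⟨ m≤m+n _ (3 * ρ) ⟩
        5 + suc ρ * suc ρ + 3 * ρ      ≡⟨ eq ρ ⟩
        (3 + ρ) * (2 + ρ)              ≡⟨ 2*triangle (2 + ρ) ⟨
        2 * triangle R                 ≡⟨ cong (triangle R +_) (+-identityʳ (triangle R)) ⟩
        triangle R + triangle R        ∎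

    -- Squared, with n ≤ s² ≤ 2 m², the left side is at most 16 n · 2 m²; this is the origin of the
    -- 32 in `32n≤E²`.
    4n≤mE : 4 * n ≤ m * E
    4n≤mE = sqr-cancel-≤ _ _ (begin
      4 * n * (4 * n)            ≡⟨ regroup n ⟩
      16 * n * n                 ≤⟨ *-monoʳ-≤ (16 * n) (≤-trans (<⇒≤ n<s²) s²≤2m²) ⟩
      16 * n * (2 * (m * m))     ≡⟨ regroup′ n m ⟩
      m * m * (32 * n)           ≤⟨ *-monoʳ-≤ (m * m) 32n≤E² ⟩
      m * m * (E * E)            ≡⟨ regroup″ m E ⟩
      m * E * (m * E)            ∎)
      where
      regroup : ∀ n → 4 * n * (4 * n) ≡ 16 * n * n
      regroup = solve-∀
      regroup′ : ∀ n m → 16 * n * (2 * (m * m)) ≡ m * m * (32 * n)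
      regroup′ = solve-∀
      regroup″ : ∀ m E → m * m * (E * E) ≡ m * E * (m * E)
      regroup″ = solve-∀

    4nPₖ≤mP₀ : 4 * n * P k ≤ m * P 0
    4nPₖ≤mP₀ = begin
      4 * n * P k                ≤⟨ *-mono-≤ 4n≤mE (decay-antitone decay [1+R]s≤k) ⟩
      m * E * P (suc R * s)      ≡⟨ *-assoc m E _ ⟩
      m * (E * P (suc R * s))    ≤⟨ *-monoʳ-≤ m (blocks decay (<⇒≤ n<s²) R R²≤s) ⟩
      m * P 0                    ∎

    sum≤[m+s]P₀ : sum {k} (P ∘ toℕ) ≤ (m + s) * P 0
    sum≤[m+s]P₀ = *-cancelˡ-≤ s (begin
      s * sum {k} (P ∘ toℕ)          ≤⟨ sum-≤ decay m k ⟩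
      (s * m + n) * P 0              ≤⟨ *-monoˡ-≤ (P 0) (+-monoʳ-≤ (s * m) (<⇒≤ n<s²)) ⟩
      (s * m + s * s) * P 0          ≡⟨ cong (_* P 0) (*-distribˡ-+ s m s) ⟨
      s * (m + s) * P 0              ≡⟨ *-assoc s (m + s) (P 0) ⟩
      s * ((m + s) * P 0)            ∎)

    -- For `W` the sum of the image sizes and `T` the number of automata, this says that the squared
    -- expectation is at most 6 n.
    W²≤6nT² : ∀ {W T} → P 0 ≡ n * T → n * W ≤ sum {k} (P ∘ toℕ) + n * P k → W * W ≤ 6 * n * (T * T)
    W²≤6nT² {W} {T} P₀≡ nW≤ = *-cancelˡ-≤ 16 (begin
      16 * (W * W)                           ≡⟨ regroup W ⟩
      4 * W * (4 * W)                        ≤⟨ *-mono-≤ 4W≤ 4W≤ ⟩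
      (9 * m + 4) * T * ((9 * m + 4) * T)    ≡⟨ regroup′ (9 * m + 4) T ⟩
      (9 * m + 4) * (9 * m + 4) * (T * T)    ≤⟨ *-monoˡ-≤ (T * T) [9m+4]²≤96n ⟩
      96 * n * (T * T)                       ≡⟨ regroup″ n (T * T) ⟩
      16 * (6 * n * (T * T))                 ∎)
      where
      regroup : ∀ W → 16 * (W * W) ≡ 4 * W * (4 * W)
      regroup = solve-∀
      regroup′ : ∀ u T → u * T * (u * T) ≡ u * u * (T * T)
      regroup′ = solve-∀
      regroup″ : ∀ n v → 96 * n * v ≡ 16 * (6 * n * v)
      regroup″ = solve-∀
      distribute : ∀ S n p → 4 * (S + n * p) ≡ 4 * S + 4 * n * p
      distribute = solve-∀
      collect : ∀ m n T → 4 * ((m + suc m) * (n * T)) + m * (n * T) ≡ n * ((9 * m + 4) * T)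
      collect = solve-∀
      commute : ∀ n W → n * (4 * W) ≡ 4 * (n * W)
      commute = solve-∀
      4W≤ : 4 * W ≤ (9 * m + 4) * T
      4W≤ = *-cancelˡ-≤ n (begin
        n * (4 * W)                                  ≡⟨ commute n W ⟩
        4 * (n * W)                                  ≤⟨ *-monoʳ-≤ 4 nW≤ ⟩
        4 * (sum {k} (P ∘ toℕ) + n * P k)            ≡⟨ distribute (sum {k} (P ∘ toℕ)) n (P k) ⟩
        4 * sum {k} (P ∘ toℕ) + 4 * n * P k          ≤⟨ +-mono-≤ (*-monoʳ-≤ 4 sum≤[m+s]P₀) 4nPₖ≤mP₀ ⟩
        4 * ((m + s) * P 0) + m * P 0                ≡⟨ cong (λ p → 4 * ((m + s) * p) + m * p) P₀≡ ⟩
        4 * ((m + s) * (n * T)) + m * (n * T)        ≡⟨ collect m n T ⟩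
        n * ((9 * m + 4) * T)                        ∎)

  log₂ : ∀ n .{{_ : NonZero n}} → Σ[ L ∈ ℕ ] 2 ^ L ≤ n × n < 2 ^ suc L
  log₂ 1 = 0 , s≤s z≤n , s≤s (s≤s z≤n)
  log₂ (suc n@(suc _)) with L , lo , hi ← log₂ n with m≤n⇒m<n∨m≡n hi
  ... | inj₁ 1+n<  = L , m≤n⇒m≤1+n lo , 1+n<
  ... | inj₂ 1+n≡  = suc L , ≤-reflexive (sym 1+n≡) ,
    subst (_< 2 ^ suc (suc L)) (sym 1+n≡) (^-monoʳ-< 2 (s≤s (s≤s z≤n)) (n<1+n (suc L)))

-- Rational bounds for √, ln and π

module Approximations where

  open import Data.Integer.Base as ℤ using (+_; -[1+_])
  import Data.Integer.Properties as ℤ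
  open import Data.Nat.Base as ℕ using (ℕ; zero; suc; NonZero; _^_)
  open import Data.Nat.Tactic.RingSolver using (solve-∀)
  open import Data.Product.Base using (Σ-syntax; _,_; proj₁; proj₂)
  open import Data.Rational.Base hiding (NonZero)
  open import Data.Rational.Properties
  open import Data.Rational.Solver using (module +-*-Solver)
  import Data.Rational.Unnormalised.Base as ℚᵘ
  import Data.Rational.Unnormalised.Properties as ℚᵘ
  open import Defs using (approx; ln; π; √_; _·_; fromℕ; harmonic; √-approx; ⌊√_⌋; ⌊√⌋-spec; IsCeiling)
  open import Relation.Binary.PropositionalEquality
  open import Relation.Nullary.Decidable using (from-yes)

  open ≤-Reasoning
  open +-*-Solver using (solve; _:+_; _:*_; _:-_; _:=_; con)

  toℚᵘ-/ : ∀ i d → toℚᵘ (i / suc d) ℚᵘ.≃ ℚᵘ.mkℚᵘ i d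
  toℚᵘ-/ i d = toℚᵘ-fromℚᵘ (ℚᵘ.mkℚᵘ i d)

  fromℕ-+ : ∀ m n → fromℕ (m ℕ.+ n) ≡ fromℕ m + fromℕ n
  fromℕ-+ m n = toℚᵘ-injective (ℚᵘ.≃-trans (toℚᵘ-/ (+ (m ℕ.+ n)) 0) (ℚᵘ.≃-sym
    (ℚᵘ.≃-trans (toℚᵘ-homo-+ (fromℕ m) (fromℕ n))
    (ℚᵘ.≃-trans (ℚᵘ.+-cong (toℚᵘ-/ (+ m) 0) (toℚᵘ-/ (+ n) 0))
    (ℚᵘ.≃-reflexive (cong (λ i → ℚᵘ.mkℚᵘ i 0)
      (cong₂ ℤ._+_ (ℤ.*-identityʳ (+ m)) (ℤ.*-identityʳ (+ n)))))))))

  fromℕ-* : ∀ m n → fromℕ (m ℕ.* n) ≡ fromℕ m * fromℕ n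
  fromℕ-* m n = toℚᵘ-injective (ℚᵘ.≃-trans (toℚᵘ-/ (+ (m ℕ.* n)) 0) (ℚᵘ.≃-sym
    (ℚᵘ.≃-trans (toℚᵘ-homo-* (fromℕ m) (fromℕ n))
    (ℚᵘ.≃-trans (ℚᵘ.*-cong (toℚᵘ-/ (+ m) 0) (toℚᵘ-/ (+ n) 0))
    (ℚᵘ.≃-reflexive (cong (λ i → ℚᵘ.mkℚᵘ i 0) (sym (ℤ.pos-* m n))))))))

  /-mono-≤ : ∀ i c j d → i ℤ.* + suc d ℤ.≤ j ℤ.* + suc c → i / suc c ≤ j / suc d
  /-mono-≤ i c j d le = toℚᵘ-cancel-≤
    (ℚᵘ.≤-respˡ-≃ (ℚᵘ.≃-sym (toℚᵘ-/ i c)) (ℚᵘ.≤-respʳ-≃ (ℚᵘ.≃-sym (toℚᵘ-/ j d)) (ℚᵘ.*≤* le)))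

  fromℕ-mono-≤ : ∀ {m n} → m ℕ.≤ n → fromℕ m ≤ fromℕ n
  fromℕ-mono-≤ {m} {n} m≤n = /-mono-≤ (+ m) 0 (+ n) 0 (ℤ.*-monoʳ-≤-nonNeg (+ 1) (ℤ.+≤+ m≤n))

  fromℕ-cancel-≤ : ∀ {m n} → fromℕ m ≤ fromℕ n → m ℕ.≤ n
  fromℕ-cancel-≤ {m} {n} le with ℚᵘ.≤-respˡ-≃ (toℚᵘ-/ (+ m) 0) (ℚᵘ.≤-respʳ-≃ (toℚᵘ-/ (+ n) 0) (toℚᵘ-mono-≤ le))
  ... | ℚᵘ.*≤* le′ = ℤ.drop‿+≤+ (ℤ.*-cancelʳ-≤-pos (+ m) (+ n) (+ 1) le′)

  /*fromℕ : ∀ m d .{{_ : NonZero d}} → (+ m / d) * fromℕ d ≡ fromℕ m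
  /*fromℕ m (suc d) = toℚᵘ-injective
    (ℚᵘ.≃-trans (toℚᵘ-homo-* (+ m / suc d) (fromℕ (suc d)))
    (ℚᵘ.≃-trans (ℚᵘ.*-cong (toℚᵘ-/ (+ m) d) (toℚᵘ-/ (+ suc d) 0))
    (ℚᵘ.≃-trans (ℚᵘ.*≡* (trans (ℤ.*-identityʳ (+ m ℤ.* + suc d))
        (cong (λ e → + m ℤ.* + e) (sym (ℕ.*-identityʳ (suc d))))))
      (ℚᵘ.≃-sym (toℚᵘ-/ (+ m) 0)))))

  /-antitone : ∀ m {c d} → c ℕ.≤ d → + m / suc d ≤ + m / suc c
  /-antitone m {c} {d} c≤d = /-mono-≤ (+ m) d (+ m) c
    (ℤ.*-monoˡ-≤-nonNeg (+ m) (ℤ.+≤+ (ℕ.s≤s c≤d)))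

  0≤/ : ∀ m d → 0ℚ ≤ + m / suc d
  0≤/ m d = /-mono-≤ (+ 0) 0 (+ m) d 
    (subst₂ ℤ._≤_ (sym (ℤ.*-zeroˡ (+ suc d))) (sym (ℤ.*-identityʳ (+ m))) (ℤ.+≤+ ℕ.z≤n))

  0≤fromℕ : ∀ m → 0ℚ ≤ fromℕ m
  0≤fromℕ m = 0≤/ m 0

  0<fromℕ-suc : ∀ m → 0ℚ < fromℕ (suc m)
  0<fromℕ-suc m = <-≤-trans (positive⁻¹ 1ℚ) (fromℕ-mono-≤ {1} {suc m} (ℕ.s≤s ℕ.z≤n))

  *-monoˡ-≤ : ∀ p {q r} → 0ℚ ≤ p → q ≤ r → p * q ≤ p * r
  *-monoˡ-≤ p 0≤p = *-monoˡ-≤-nonNeg p {{nonNegative 0≤p}}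

  *-mono-≤ : ∀ {p q r s} → 0ℚ ≤ p → 0ℚ ≤ r → p ≤ q → r ≤ s → p * r ≤ q * s
  *-mono-≤ {p} {q} {r} {s} 0≤p 0≤r p≤q r≤s = ≤-trans (*-monoˡ-≤ p 0≤p r≤s)
    (*-monoʳ-≤-nonNeg s {{nonNegative (≤-trans 0≤r r≤s)}} p≤q)

  sqr-cancel-≤ : ∀ p r → 0ℚ ≤ r → p * p ≤ r * r → p ≤ r
  sqr-cancel-≤ p r 0≤r p²≤r² = ≮⇒≥ λ r<p → <-irrefl refl (<-≤-trans
    (≤-<-trans (*-monoˡ-≤ r 0≤r (<⇒≤ r<p))
               (*-monoˡ-<-pos p {{positive (≤-<-trans 0≤r r<p)}} r<p)) p²≤r²)

  *-cancelʳ-≤fromℕ : ∀ {p q} m .{{_ : NonZero m}} → p * fromℕ m ≤ q * fromℕ m → p ≤ q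
  *-cancelʳ-≤fromℕ (suc m) = *-cancelʳ-≤-pos (fromℕ (suc m)) {{positive (0<fromℕ-suc m)}}

  √-approx-nonNeg : ∀ m q → 0ℚ ≤ √-approx m q
  √-approx-nonNeg m q@(mkℚ i d _) = 0≤/ ⌊√ ℤ.∣ i ∣ ℕ.* suc d ℕ.* (suc m ℕ.* suc m) ⌋ (m ℕ.+ d ℕ.* suc m)

  -- Multiplied twice by the denominator `D`, both sides are integers: `v` on the left and the
  -- square of `s + suc d` on the right. The summand 1 / M has become `suc d`, which is at least the
  -- 1 lost in rounding down.
  √-approx-upper : ∀ m {q} → 0ℚ ≤ q → let r = √-approx m q + + 1 / suc m in q ≤ r * r
  √-approx-upper m {q@(mkℚ -[1+ _ ] _ _)} 0≤q with () ← nonNegative 0≤q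
  √-approx-upper m {q@(mkℚ (+ u) d c)} 0≤q = *-cancelʳ-≤fromℕ D (*-cancelʳ-≤fromℕ D
    (subst₂ _≤_ (sym qD²) (sym r²D²) (fromℕ-mono-≤ (ℕ.≤-trans (ℕ.<⇒≤ (proj₂ (⌊√⌋-spec v)))
      (ℕ.*-mono-≤ 1+s≤ 1+s≤)))))
    where
    M D v s : ℕ
    M = suc m
    D = suc d ℕ.* M
    v = u ℕ.* suc d ℕ.* (M ℕ.* M)
    s = ⌊√ v ⌋
    r = √-approx m q + + 1 / suc m
    rD : r * fromℕ D ≡ fromℕ (s ℕ.+ suc d)
    rD = begin-equality
      (+ s / D + + 1 / M) * fromℕ D                  ≡⟨ *-distribʳ-+ (fromℕ D) (+ s / D) (+ 1 / M) ⟩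
      + s / D * fromℕ D + + 1 / M * fromℕ D
        ≡⟨ cong₂ _+_ (/*fromℕ s D) (cong (+ 1 / M *_) (trans (cong fromℕ (ℕ.*-comm (suc d) M)) (fromℕ-* M (suc d)))) ⟩
      fromℕ s + + 1 / M * (fromℕ M * fromℕ (suc d))
        ≡⟨ cong (_+_ (fromℕ s)) (*-assoc (+ 1 / M) (fromℕ M) (fromℕ (suc d))) ⟨
      fromℕ s + + 1 / M * fromℕ M * fromℕ (suc d)
        ≡⟨ cong (λ z → fromℕ s + z * fromℕ (suc d)) (/*fromℕ 1 M) ⟩
      fromℕ s + 1ℚ * fromℕ (suc d)                   ≡⟨ cong (_+_ (fromℕ s)) (*-identityˡ (fromℕ (suc d))) ⟩
      fromℕ s + fromℕ (suc d)                        ≡⟨ fromℕ-+ s (suc d) ⟨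
      fromℕ (s ℕ.+ suc d)                            ∎
    qd : q * fromℕ (suc d) ≡ fromℕ u
    qd = trans (cong (_* fromℕ (suc d)) (sym (↥p/↧p≡p q))) (/*fromℕ u (suc d))
    qD² : q * fromℕ D * fromℕ D ≡ fromℕ v
    qD² = begin-equality
      q * fromℕ D * fromℕ D
        ≡⟨ cong (λ z → q * z * fromℕ D) (fromℕ-* (suc d) M) ⟩
      q * (fromℕ (suc d) * fromℕ M) * fromℕ D
        ≡⟨ cong (_* fromℕ D) (*-assoc q (fromℕ (suc d)) (fromℕ M)) ⟨
      q * fromℕ (suc d) * fromℕ M * fromℕ D                        ≡⟨ cong (λ z → z * fromℕ M * fromℕ D) qd ⟩
      fromℕ u * fromℕ M * fromℕ D                                  ≡⟨ cong (_* fromℕ D) (fromℕ-* u M) ⟨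
      fromℕ (u ℕ.* M) * fromℕ D                                    ≡⟨ fromℕ-* (u ℕ.* M) D ⟨
      fromℕ (u ℕ.* M ℕ.* D)                                        ≡⟨ cong fromℕ (regroup u (suc d) M) ⟩
      fromℕ v                                                      ∎
      where
      regroup : ∀ u d M → u ℕ.* M ℕ.* (d ℕ.* M) ≡ u ℕ.* d ℕ.* (M ℕ.* M)
      regroup = solve-∀
    r²D² : r * r * fromℕ D * fromℕ D ≡ fromℕ ((s ℕ.+ suc d) ℕ.* (s ℕ.+ suc d))
    r²D² = begin-equality
      r * r * fromℕ D * fromℕ D                  ≡⟨ regroup r (fromℕ D) ⟩
      r * fromℕ D * (r * fromℕ D)                ≡⟨ cong₂ _*_ rD rD ⟩
      fromℕ (s ℕ.+ suc d) * fromℕ (s ℕ.+ suc d)  ≡⟨ fromℕ-* (s ℕ.+ suc d) (s ℕ.+ suc d) ⟨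
      fromℕ ((s ℕ.+ suc d) ℕ.* (s ℕ.+ suc d))    ∎
      where
      regroup : ∀ r D → r * r * D * D ≡ r * D * (r * D)
      regroup = solve 2 (λ r D → r :* r :* D :* D := r :* D :* (r :* D)) refl
    1+s≤ : suc s ℕ.≤ s ℕ.+ suc d
    1+s≤ = ℕ.≤-trans (ℕ.s≤s (ℕ.m≤m+n s d)) (ℕ.≤-reflexive (sym (ℕ.+-suc s d)))

  ≤-√-approx : ∀ m {p q} → 0ℚ ≤ q → p * p ≤ q → p ≤ √-approx m q + + 1 / suc m
  ≤-√-approx m {p} {q} 0≤q p²≤q = sqr-cancel-≤ p _
    (+-mono-≤ (√-approx-nonNeg m q) (0≤/ 1 m)) (≤-trans p²≤q (√-approx-upper m 0≤q))

  harmonic-+-≤ : ∀ m d r → m ℕ.+ r ℕ.≤ suc d → harmonic m + fromℕ r * (+ 1 / suc d) ≤ harmonic (m ℕ.+ r)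
  harmonic-+-≤ m d zero    _  = ≤-reflexive (trans (cong (_+_ (harmonic m)) (*-zeroˡ (+ 1 / suc d)))
    (trans (+-identityʳ (harmonic m)) (cong harmonic (sym (ℕ.+-identityʳ m)))))
  harmonic-+-≤ m d (suc r) le = begin
    harmonic m + fromℕ (suc r) * t          ≡⟨ cong (λ z → harmonic m + z * t) (fromℕ-+ 1 r) ⟩
    harmonic m + (1ℚ + fromℕ r) * t         ≡⟨ regroup (harmonic m) (fromℕ r) t ⟩
    harmonic m + fromℕ r * t + t
      ≤⟨ +-mono-≤ (harmonic-+-≤ m d r (ℕ.<⇒≤ m+r<1+d)) (/-antitone 1 (ℕ.≤-pred m+r<1+d)) ⟩
    harmonic (suc (m ℕ.+ r))                ≡⟨ cong harmonic (ℕ.+-suc m r) ⟨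
    harmonic (m ℕ.+ suc r)                  ∎
    where
    t = + 1 / suc d
    m+r<1+d : suc (m ℕ.+ r) ℕ.≤ suc d
    m+r<1+d = subst (ℕ._≤ suc d) (ℕ.+-suc m r) le
    regroup : ∀ h r t → h + (1ℚ + r) * t ≡ h + r * t + t
    regroup = solve 3 (λ h r t → h :+ (con 1ℚ :+ r) :* t := h :+ r :* t :+ t) refl

  harmonic-mono-≤ : ∀ {m n} → m ℕ.≤ n → harmonic m ≤ harmonic n
  harmonic-mono-≤ {m} m≤n = go (ℕ.≤⇒≤′ m≤n)
    where
    go : ∀ {n} → m ℕ.≤′ n → harmonic m ≤ harmonic n
    go ℕ.≤′-refl = ≤-refl
    go {suc n} (ℕ.≤′-step m≤n) = ≤-trans (go m≤n)
      (≤-trans (≤-reflexive (sym (+-identityʳ (harmonic n)))) (+-monoʳ-≤ (harmonic n) (0≤/ 1 n)))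

  -- Each of the `m` added terms is at least 1 / (2 m).
  harmonic-double : ∀ m .{{_ : NonZero m}} → harmonic m + ½ ≤ harmonic (m ℕ.+ m)
  harmonic-double m@(suc m′) = ≤-trans (≤-reflexive (cong (_+_ (harmonic m)) (sym half)))
    (harmonic-+-≤ m (m′ ℕ.+ m) m ℕ.≤-refl)
    where
    t = + 1 / (m ℕ.+ m)
    half : fromℕ m * t ≡ ½
    half = begin-equality
      fromℕ m * t                    ≡⟨ regroup (fromℕ m) t ⟩
      ½ * (t * (fromℕ m + fromℕ m))  ≡⟨ cong (λ z → ½ * (t * z)) (fromℕ-+ m m) ⟨
      ½ * (t * fromℕ (m ℕ.+ m))      ≡⟨ cong (½ *_) (/*fromℕ 1 (m ℕ.+ m)) ⟩
      ½                              ∎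
      where
      regroup : ∀ x t → x * t ≡ ½ * (t * (x + x))
      regroup = solve 2 (λ x t → x :* t := con ½ :* (t :* (x :+ x))) refl

  harmonic-2^ : ∀ L m .{{_ : NonZero m}} → harmonic m + fromℕ L * ½ ≤ harmonic (2 ^ L ℕ.* m)
  harmonic-2^ zero    m = ≤-reflexive (trans (+-identityʳ (harmonic m)) (cong harmonic (sym (ℕ.+-identityʳ m))))
  harmonic-2^ (suc L) m = begin
    harmonic m + fromℕ (suc L) * ½          ≡⟨ cong (λ z → harmonic m + z * ½) (fromℕ-+ 1 L) ⟩
    harmonic m + (1ℚ + fromℕ L) * ½         ≡⟨ regroup (harmonic m) (fromℕ L) ⟩
    harmonic m + fromℕ L * ½ + ½            ≤⟨ +-monoˡ-≤ ½ (harmonic-2^ L m) ⟩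
    harmonic (2 ^ L ℕ.* m) + ½
      ≤⟨ harmonic-double (2 ^ L ℕ.* m) {{ℕ.m*n≢0 (2 ^ L) m {{ℕ.m^n≢0 2 L}}}} ⟩
    harmonic (2 ^ L ℕ.* m ℕ.+ 2 ^ L ℕ.* m)  ≡⟨ cong harmonic (double (2 ^ L) m) ⟩
    harmonic (2 ^ suc L ℕ.* m)              ∎
    where
    regroup : ∀ h l → h + (1ℚ + l) * ½ ≡ h + l * ½ + ½
    regroup = solve 2 (λ h l → h :+ (con 1ℚ :+ l) :* con ½ := h :+ l :* con ½ :+ con ½) refl
    double : ∀ e m → e ℕ.* m ℕ.+ e ℕ.* m ≡ 2 ℕ.* e ℕ.* m
    double = solve-∀

  -- Multiplying the index `suc i` by `n` includes `L` doublings, each worth ½. The bound is the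
  -- same at every stage of the approximation.
  ln-≥ : ∀ n .{{_ : NonZero n}} L → 2 ^ L ℕ.≤ n → ∀ i → fromℕ L * ½ ≤ approx (ln n) i
  ln-≥ n@(suc _) L 2^L≤n i = begin
    fromℕ L * ½                                          ≡⟨ regroup (fromℕ L * ½) (harmonic (suc i)) ⟩
    harmonic (suc i) + fromℕ L * ½ - harmonic (suc i)
      ≤⟨ +-monoˡ-≤ (- harmonic (suc i)) (≤-trans (harmonic-2^ L (suc i)) (harmonic-mono-≤ (ℕ.*-monoˡ-≤ (suc i) 2^L≤n))) ⟩
    harmonic (n ℕ.* suc i) - harmonic (suc i)            ∎
    where
    regroup : ∀ x h → x ≡ h + x - h
    regroup = solve 2 (λ x h → x := h :+ x :- h) refl

  -- A single late approximation suffices. The real inequality with ε = 1 costs 1, and twice the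
  -- rounding error of the square root costs at most 1 more; hence `k + 2`.
  ceiling-≥ : ∀ n .{{_ : NonZero n}} L → 2 ^ L ℕ.≤ n → ∀ k →
              IsCeiling k (fromℕ 2 · √ (fromℕ n · ln n)) → 2 ℕ.* (n ℕ.* L) ℕ.≤ (k ℕ.+ 2) ℕ.* (k ℕ.+ 2)
  ceiling-≥ n L 2^L≤n k (_ , ≤k) = fromℕ-cancel-≤ (begin
    fromℕ (2 ℕ.* (n ℕ.* L))
      ≡⟨ trans (fromℕ-* 2 (n ℕ.* L)) (cong (fromℕ 2 *_) (fromℕ-* n L)) ⟩
    fromℕ 2 * (fromℕ n * fromℕ L)                ≡⟨ regroup (fromℕ n) (fromℕ L) ⟩
    fromℕ 4 * (fromℕ n * (fromℕ L * ½))
      ≤⟨ *-monoˡ-≤ (fromℕ 4) (0≤fromℕ 4) (*-monoˡ-≤ (fromℕ n) (0≤fromℕ n) (ln-≥ n L 2^L≤n i)) ⟩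
    fromℕ 4 * q                                  ≤⟨ *-monoˡ-≤ (fromℕ 4) (0≤fromℕ 4) (√-approx-upper i 0≤q) ⟩
    fromℕ 4 * (r * r)                            ≡⟨ regroup′ r ⟩
    fromℕ 2 * r * (fromℕ 2 * r)                  ≤⟨ *-mono-≤ 0≤2r 0≤2r 2r≤k+2 2r≤k+2 ⟩
    fromℕ (k ℕ.+ 2) * fromℕ (k ℕ.+ 2)            ≡⟨ fromℕ-* (k ℕ.+ 2) (k ℕ.+ 2) ⟨
    fromℕ ((k ℕ.+ 2) ℕ.* (k ℕ.+ 2))              ∎)
    where
    N i : ℕ
    N = proj₁ (≤k 1ℚ (positive⁻¹ 1ℚ))
    i = suc N  -- so that 1 / (i + 1) ≤ ½
    q = fromℕ n * approx (ln n) i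
    regroup : ∀ x y → fromℕ 2 * (x * y) ≡ fromℕ 4 * (x * (y * ½))
    regroup = solve 2 (λ x y → con (fromℕ 2) :* (x :* y) := con (fromℕ 4) :* (x :* (y :* con ½))) refl
    regroup′ : ∀ r → fromℕ 4 * (r * r) ≡ fromℕ 2 * r * (fromℕ 2 * r)
    regroup′ = solve 1 (λ r → con (fromℕ 4) :* (r :* r) := con (fromℕ 2) :* r :* (con (fromℕ 2) :* r)) refl
    r = √-approx i q + + 1 / suc i
    *-nonNeg : ∀ {x y} → 0ℚ ≤ x → 0ℚ ≤ y → 0ℚ ≤ x * y
    *-nonNeg {x} 0≤x 0≤y = ≤-trans (≤-reflexive (sym (*-zeroʳ x))) (*-monoˡ-≤ x 0≤x 0≤y)
    0≤q : 0ℚ ≤ q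
    0≤q = *-nonNeg (0≤fromℕ n) (≤-trans (*-nonNeg (0≤fromℕ L) (nonNegative⁻¹ ½)) (ln-≥ n L 2^L≤n i))
    0≤2r : 0ℚ ≤ fromℕ 2 * r
    0≤2r = *-nonNeg (0≤fromℕ 2) (+-mono-≤ (√-approx-nonNeg i q) (0≤/ 1 i))
    2r≤k+2 : fromℕ 2 * r ≤ fromℕ (k ℕ.+ 2)
    2r≤k+2 = begin
      fromℕ 2 * r
        ≡⟨ *-distribˡ-+ (fromℕ 2) (√-approx i q) (+ 1 / suc i) ⟩
      fromℕ 2 * √-approx i q + fromℕ 2 * (+ 1 / suc i)
        ≤⟨ +-mono-≤ (proj₂ (≤k 1ℚ (positive⁻¹ 1ℚ)) i (ℕ.n≤1+n N))
                                                                (*-monoˡ-≤ (fromℕ 2) (0≤fromℕ 2) (/-antitone 1 {1} {i} (ℕ.s≤s ℕ.z≤n))) ⟩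
      fromℕ k + 1ℚ + 1ℚ                                    ≡⟨ +-assoc (fromℕ k) 1ℚ 1ℚ ⟩
      fromℕ k + fromℕ 2                                    ≡⟨ fromℕ-+ k 2 ⟨
      fromℕ (k ℕ.+ 2)                                      ∎

  -- Index 3 means four pairs of Leibniz terms, the first partial sum above 3; it is checked by
  -- computation, and later pairs are nonnegative.
  π-≥3 : ∀ i → fromℕ 3 ≤ approx π (3 ℕ.+ i)
  π-≥3 zero    = from-yes (fromℕ 3 ≤? approx π 3)
  π-≥3 (suc i) = begin
    fromℕ 3                            ≤⟨ π-≥3 i ⟩
    approx π j                         ≡⟨ +-identityʳ (approx π j) ⟨
    approx π j + 0ℚ                    ≡⟨ cong (_+_ (approx π j)) (+-inverseʳ p) ⟨
    approx π j + (p - p)               ≤⟨ +-monoʳ-≤ (approx π j) (+-monoˡ-≤ (- p)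
                                            (/-antitone 4 (ℕ.m≤n+m (4 ℕ.* suc j) 2))) ⟩
    approx π (suc j)                   ∎
    where
    j = 3 ℕ.+ i
    p = + 4 / (3 ℕ.+ 4 ℕ.* suc j)

  small-reciprocal : ∀ ε → 0ℚ < ε → Σ[ N ∈ ℕ ] + 1 / suc N ≤ ε
  small-reciprocal ε@(mkℚ (+ suc p) d _) _ = d , (begin
    + 1 / suc d
      ≤⟨ /-mono-≤ (+ 1) d (+ suc p) d (ℤ.*-monoʳ-≤-nonNeg (+ suc d) (ℤ.+≤+ (ℕ.s≤s (ℕ.z≤n {p})))) ⟩
    + suc p / suc d      ≡⟨ ↥p/↧p≡p ε ⟩
    ε                    ∎)
  small-reciprocal (mkℚ (+ zero) _ _)  0<ε with () ← positive 0<ε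
  small-reciprocal (mkℚ -[1+ _ ] _ _) 0<ε with () ← positive 0<ε

-- The expectation and the error term

module Expectation where

  open import Algebra.Properties.CommutativeMonoid.Sum ℕ.+-0-commutativeMonoid using (sum)
  open Counting using (module Count; sum-mono-≤; sum-const)
  open import Data.Fin.Subset using (⊤; ∣_∣)
  open import Data.Fin.Subset.Properties using (∣p∣≤n)
  open import Data.Integer.Base using (+_)
  open import Data.List.Base using (replicate)
  open import Data.Nat.Base as ℕ using (ℕ; zero; suc; NonZero; _^_)
  open import Data.Nat.Tactic.RingSolver using (solve-∀)
  open import Data.Product.Base using (_,_; proj₁; proj₂)
  open import Data.Rational.Base hiding (NonZero; ∣_∣)
  import Data.Rational.Base as ℚ
  open import Data.Rational.Properties
  open import Data.Rational.Solver using (module +-*-Solver)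
  open import Defs hiding (_≤_; _<_)
  open Approximations
  open Decaying using (mkDecay; module Asymptotic; log₂)
  open import Relation.Binary.PropositionalEquality
  open import Relation.Nullary

  open ≤-Reasoning

  module _ (n : ℕ) .{{_ : NonZero n}} (X : Automaton n → ℕ) where

    private
      T = n ^ (n ℕ.* 2)
      W = sum λ i → X (automaton n i)
      instance
        T≢0 : NonZero T
        T≢0 = ℕ.m^n≢0 n (n ℕ.* 2)

    𝔼*T : 𝔼 n X * fromℕ T ≡ fromℕ W
    𝔼*T = /*fromℕ W T

    𝔼-≤ : ∀ c → (∀ δ → X δ ℕ.≤ c) → 𝔼 n X ≤ fromℕ c
    𝔼-≤ c X≤c = *-cancelʳ-≤fromℕ T (begin
      𝔼 n X * fromℕ T      ≡⟨ 𝔼*T ⟩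
      fromℕ W
        ≤⟨ fromℕ-mono-≤ (ℕ.≤-trans (sum-mono-≤ λ i → X≤c (automaton n i)) (ℕ.≤-reflexive (trans (sum-const T c) (ℕ.*-comm T c)))) ⟩
      fromℕ (c ℕ.* T)      ≡⟨ fromℕ-* c T ⟩
      fromℕ c * fromℕ T    ∎)

    𝔼²-≤ : ∀ c → W ℕ.* W ℕ.≤ c ℕ.* (T ℕ.* T) → 𝔼 n X * 𝔼 n X ≤ fromℕ c
    𝔼²-≤ c W²≤ = *-cancelʳ-≤fromℕ T (*-cancelʳ-≤fromℕ T (begin
      E * E * t * t                ≡⟨ regroup E t ⟩
      E * t * (E * t)              ≡⟨ cong₂ _*_ 𝔼*T 𝔼*T ⟩
      fromℕ W * fromℕ W            ≡⟨ fromℕ-* W W ⟨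
      fromℕ (W ℕ.* W)              ≤⟨ fromℕ-mono-≤ W²≤ ⟩
      fromℕ (c ℕ.* (T ℕ.* T))      ≡⟨ trans (fromℕ-* c (T ℕ.* T)) (cong (_*_ (fromℕ c)) (fromℕ-* T T)) ⟩
      fromℕ c * (t * t)            ≡⟨ *-assoc (fromℕ c) t t ⟨
      fromℕ c * t * t              ∎))
      where
      E = 𝔼 n X
      t = fromℕ T
      open +-*-Solver
      regroup : ∀ r D → r * r * D * D ≡ r * D * (r * D)
      regroup = solve 2 (λ r D → r :* r :* D :* D := r :* D :* (r :* D)) refl

  -- Beyond it L ≥ 225 = 15², which Asymptotic requires.
  threshold : ℕ
  threshold = 2 ^ 225

  -- The decision is an argument so that proofs can be stated for an arbitrary decision and match on
  -- it.
  error-if : ∀ n → Dec (n ℕ.< threshold) → ℚ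
  error-if n (yes _) = fromℕ n
  error-if n (no _)  = 0ℚ

  error : ℕ → ℚ
  error n = error-if n (n ℕ.<? threshold)

  error-vanishing : Vanishing error
  error-vanishing ε 0<ε = threshold , bound
    where
    bound : ∀ n → threshold ℕ.≤ n → ℚ.∣ error n ∣ ≤ ε
    bound n t≤n = go (n ℕ.<? threshold)
      where
      go : ∀ n<t? → ℚ.∣ error-if n n<t? ∣ ≤ ε
      go (yes n<t) = contradiction t≤n (ℕ.<⇒≱ n<t)
      go (no  _)   = <⇒≤ 0<ε

  sum-image-size² : ∀ n {{_ : NonZero n}} k {L} → 225 ℕ.≤ L → 2 ^ L ℕ.≤ n → n ℕ.< 2 ^ suc L →
    2 ℕ.* (n ℕ.* L) ℕ.≤ (k ℕ.+ 2) ℕ.* (k ℕ.+ 2) →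
    let W = sum (Count.image-size n k); T = n ^ (n ℕ.* 2) in
    W ℕ.* W ℕ.≤ 6 ℕ.* n ℕ.* (T ℕ.* T)
  sum-image-size² n k 225≤L 2^L≤n n<2^1+L 2nL≤ = Asymptotic.W²≤6nT² {P = Count.paths n}
    (mkDecay (Count.paths-suc n)) 225≤L 2^L≤n n<2^1+L {k = k} 2nL≤
    {sum (Count.image-size n k)} {n ^ (n ℕ.* 2)} (Count.paths-0 n) (Count.sum-image-size n k)

  module _ (n : ℕ) .{{_ : NonZero n}} (k : ℕ) where

    image-size : Automaton n → ℕ
    image-size δ = ∣ image (δ⟨ replicate k a ⟩ δ) ⊤ ∣

    √2nπ : ℕ → ℚ
    √2nπ i = √-approx i (fromℕ (2 ℕ.* n) * approx π i)

    6n≤2nπ : ∀ i → 3 ℕ.≤ i → fromℕ (6 ℕ.* n) ≤ fromℕ (2 ℕ.* n) * approx π i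
    6n≤2nπ i 3≤i = begin
      fromℕ (6 ℕ.* n)                      ≡⟨ cong fromℕ (regroup n) ⟩
      fromℕ (2 ℕ.* n ℕ.* 3)                ≡⟨ fromℕ-* (2 ℕ.* n) 3 ⟩
      fromℕ (2 ℕ.* n) * fromℕ 3
        ≤⟨ *-monoˡ-≤ (fromℕ (2 ℕ.* n)) (0≤fromℕ (2 ℕ.* n)) (subst (λ i → fromℕ 3 ≤ approx π i) (ℕ.m+[n∸m]≡n 3≤i) (π-≥3 (i ℕ.∸ 3))) ⟩
      fromℕ (2 ℕ.* n) * approx π i         ∎
      where
      regroup : ∀ n → 6 ℕ.* n ≡ 2 ℕ.* n ℕ.* 3
      regroup = solve-∀

    ≤√2nπ : ∀ {p} → p * p ≤ fromℕ (6 ℕ.* n) → ∀ i → 3 ℕ.≤ i → p ≤ √2nπ i + + 1 / suc i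
    ≤√2nπ p²≤ i 3≤i = ≤-√-approx i (≤-trans (0≤fromℕ (6 ℕ.* n)) (6n≤2nπ i 3≤i)) (≤-trans p²≤ (6n≤2nπ i 3≤i))

    -- The root is at least √ (6 n) ≥ 2, and its approximation errs by at most 1.
    1≤√2nπ : ∀ i → 3 ℕ.≤ i → 1ℚ ≤ √2nπ i
    1≤√2nπ i 3≤i = begin
      1ℚ
        ≤⟨ +-monoˡ-≤ (- 1ℚ) (≤-trans (≤√2nπ {fromℕ 2} 4≤6n i 3≤i) (+-monoʳ-≤ (√2nπ i) (/-antitone 1 (ℕ.z≤n {i})))) ⟩
      √2nπ i + 1ℚ - 1ℚ                  ≡⟨ +-assoc (√2nπ i) 1ℚ (- 1ℚ) ⟩
      √2nπ i + 0ℚ                       ≡⟨ +-identityʳ (√2nπ i) ⟩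
      √2nπ i                            ∎
      where
      4≤6n : fromℕ 2 * fromℕ 2 ≤ fromℕ (6 ℕ.* n)
      4≤6n = fromℕ-mono-≤ {4} (ℕ.≤-trans (ℕ.≤ᵇ⇒≤ 4 6 _) (ℕ.m≤m*n 6 n))

    -- The image has at most `n` states and the root is at least 1, so an error term of `n` is
    -- always enough.
    small-bound : fromℚ (𝔼 n image-size) Defs.≤ (1ℚ + fromℕ n) · √ (fromℕ (2 ℕ.* n) · π)
    small-bound ε 0<ε = 3 , λ i 3≤i → begin
      𝔼 n image-size                    ≤⟨ 𝔼-≤ n image-size n (λ δ → ∣p∣≤n (image (δ⟨ replicate k a ⟩ δ) ⊤)) ⟩
      fromℕ n                           ≡⟨ +-identityˡ (fromℕ n) ⟨
      0ℚ + fromℕ n                      ≤⟨ +-monoˡ-≤ (fromℕ n) (nonNegative⁻¹ 1ℚ) ⟩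
      1ℚ + fromℕ n                      ≡⟨ *-identityʳ (1ℚ + fromℕ n) ⟨
      (1ℚ + fromℕ n) * 1ℚ
        ≤⟨ *-monoˡ-≤ (1ℚ + fromℕ n) (+-mono-≤ (nonNegative⁻¹ 1ℚ) (0≤fromℕ n)) (1≤√2nπ i 3≤i) ⟩
      (1ℚ + fromℕ n) * √2nπ i           ≡⟨ +-identityʳ _ ⟨
      (1ℚ + fromℕ n) * √2nπ i + 0ℚ      ≤⟨ +-monoʳ-≤ ((1ℚ + fromℕ n) * √2nπ i) (<⇒≤ 0<ε) ⟩
      (1ℚ + fromℕ n) * √2nπ i + ε       ∎

    -- The squared expectation is at most 6 n, hence at most 2 n times each late approximation of π;
    -- the rounding 1 / (i + 1) of the root goes into ε.
    large-bound : threshold ℕ.≤ n → IsCeiling k (fromℕ 2 · √ (fromℕ n · ln n)) →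
                  fromℚ (𝔼 n image-size) Defs.≤ (1ℚ + 0ℚ) · √ (fromℕ (2 ℕ.* n) · π)
    large-bound t≤n ceiling ε 0<ε = N ℕ.⊔ 3 , λ i N⊔3≤i → begin
      𝔼 n image-size                    ≤⟨ ≤√2nπ 𝔼²≤6n i (ℕ.≤-trans (ℕ.m≤n⊔m N 3) N⊔3≤i) ⟩
      √2nπ i + + 1 / suc i              ≤⟨ +-mono-≤ (≤-reflexive (sym (*-identityˡ (√2nπ i))))
                                             (≤-trans (/-antitone 1 (ℕ.≤-trans (ℕ.m≤m⊔n N 3) N⊔3≤i)) (proj₂ (small-reciprocal ε 0<ε))) ⟩
      (1ℚ + 0ℚ) * √2nπ i + ε            ∎
      where
      N L : ℕ
      N = proj₁ (small-reciprocal ε 0<ε)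
      L = proj₁ (log₂ n)
      2^L≤n : 2 ^ L ℕ.≤ n
      2^L≤n = proj₁ (proj₂ (log₂ n))
      n<2^1+L : n ℕ.< 2 ^ suc L
      n<2^1+L = proj₂ (proj₂ (log₂ n))
      225≤L : 225 ℕ.≤ L
      225≤L = ℕ.≮⇒≥ λ L<225 → ℕ.<⇒≱ (ℕ.<-≤-trans n<2^1+L (ℕ.^-monoʳ-≤ 2 L<225)) t≤n
      𝔼²≤6n : 𝔼 n image-size * 𝔼 n image-size ≤ fromℕ (6 ℕ.* n)
      𝔼²≤6n = 𝔼²-≤ n image-size (6 ℕ.* n)
        (sum-image-size² n {{ℕ.≢-nonZero (ℕ.≢-nonZero⁻¹ n)}} k 225≤L 2^L≤n n<2^1+L
          (ceiling-≥ n L 2^L≤n k ceiling))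

  image-size-bound : ∀ n → .{{_ : NonZero n}} → ∀ k → IsCeiling k (fromℕ 2 · √ (fromℕ n · ln n)) →
    fromℚ (𝔼 n (image-size n k)) Defs.≤ (1ℚ + error n) · √ (fromℕ (2 ℕ.* n) · π)
  image-size-bound n k ceiling = go (n ℕ.<? threshold)
    where
    go : ∀ n<t? → fromℚ (𝔼 n (image-size n k)) Defs.≤ (1ℚ + error-if n n<t?) · √ (fromℕ (2 ℕ.* n) · π)
    go (yes _)   = small-bound n k
    go (no  n≮t) = large-bound n k (ℕ.≮⇒≥ n≮t) ceiling

open import Defs
open import Data.Fin.Subset using (⊤; ∣_∣)
open import Data.List.Base using (replicate)
open import Data.Nat.Base using (ℕ; NonZero; _*_)
open import Data.Product.Base using (Σ-syntax; _×_; _,_)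
open import Data.Rational.Base using (ℚ; 1ℚ; _+_)

theorem1p1 : Σ[ o ∈ (ℕ → ℚ) ] Vanishing o ×
    (∀ n → .{{_ : NonZero n}} → ∀ k →
    IsCeiling k (fromℕ 2 · √ (fromℕ n · ln n)) →
    fromℚ (𝔼 n (λ δ → ∣ image (δ⟨ replicate k a ⟩ δ) ⊤ ∣))
    ≤ (1ℚ + o n) · √ (fromℕ (2 * n) · π))
theorem1p1 = Expectation.error , Expectation.error-vanishing , Expectation.image-size-bound
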